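{- Let $n\ge 1$ and $\pi,\sigma\in\mathfrak{B}_n$, and let $(\ell_1,\ell_2,\ell_3,\ell_4)$ be the length vector of $\sigma$. Then: (1) $\pi\le\sigma$ if and only if $f_{2143}(\pi)\ge f_{2143}(\sigma)$; (2) $\beta(\sigma)=\frac12\ell_2\ell_3(\ell_2+\ell_3)$; (3) $\alpha(\sigma)=\frac12\ell_1\ell_4(\ell_1+\ell_4)$; (4) $\beta(\sigma)=\alpha(f_{2143}(\sigma))$.
   Context: $\mathfrak{S}_n$ is the set of permutations of $[n]=\{1,\dots,n\}$, in one-line notation. A reduction of $\omega\in\mathfrak{S}_n$ interchanges $\omega(i)$ and $\omega(j)$ for some $i<j$ with $\omega(i)>\omega(j)$. Bruhat order: $\pi\le\sigma$ if $\pi$ is obtained from $\sigma$ by a (possibly empty) sequence of reductions. $\mathfrak{B}_n\subseteq\mathfrak{S}_n$ is the set of bigrassmannian permutations (both $\omega$ and $\omega^{ -1}$ have exactly one descent); equivalently $\omega=1\cdots a\,(b+1)\cdots c\,(a+1)\cdots b\,(c+1)\cdots n$ for a unique triple $0\le a<b<c\le n$. The length vector of such an element is $(\ell_1,\ell_2,\ell_3,\ell_4)=(a+1,b-a,c-b,n+1-c)$; this gives a bijection between $\mathfrak{B}_n$ and vectors of four positive integers with sum $n+2$. For $\sigma\in\mathfrak{B}_n$ with length vector $(\ell_1,\ell_2,\ell_3,\ell_4)$, $f_{2143}(\sigma)$ is the element of $\mathfrak{B}_n$ with length vector $(\ell_2,\ell_1,\ell_4,\ell_3)$. $\beta(\sigma)$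 is the number of $\pi\in\mathfrak{B}_n$ with $\pi\le\sigma$, and $\alpha(\sigma)$ is the number of $\tau\in\mathfrak{B}_n$ with $\sigma\le\tau$. -}

module Defs where

open import Data.Fin.Base as Fin using (Fin; toℕ; fromℕ<)
open import Data.Fin.Permutation
  using (Permutation′; permutation; _⟨$⟩ʳ_; _⟨$⟩ˡ_; _≈_; _∘ₚ_; transpose; flip;
         inverseˡ; inverseʳ)
open import Data.Fin.Properties using (toℕ-injective; toℕ<n; toℕ-fromℕ<)
open import Data.Nat.Base
open import Data.Nat.Properties
open import Data.Nat.Tactic.RingSolver using (solve-∀)
open import Data.Product using (∃; ∃₂; ∃-syntax; ∃!; Σ; _×_; _,_; proj₁; proj₂)
open import Data.Sum.Base using (_⊎_; inj₁; inj₂)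
open import Function.Bundles using (Inverse)
open import Level using (0ℓ)
open import Relation.Binary.Bundles using (Setoid)
open import Relation.Binary.Construct.Closure.ReflexiveTransitive using (Star)
import Relation.Binary.Construct.On as On
open import Relation.Binary.Definitions using (tri<; tri≈; tri>)
open import Relation.Binary.PropositionalEquality
open import Relation.Nullary using (yes; no; contradiction)

-- Permutations of {1,…,n} are represented as permutations of Fin n, so
-- positions and values are shifted down by one.

private
  variable
    n : ℕ

-- transpose i j ∘ₚ σ applies the transposition first, so it is σ with the
-- entries at positions i and j interchanged.
_reducesTo_ : Permutation′ n → Permutation′ n → Set
σ reducesTo τ = ∃₂ λ i j →
  i Fin.< j × σ ⟨$⟩ʳ i Fin.> σ ⟨$⟩ʳ j × τ ≈ transpose i j ∘ₚ σ

-- Permutations carry proofs of bijectivity, so the end of a chain of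
-- reductions is compared with π by pointwise equality.
_≤ᴮ_ : Permutation′ n → Permutation′ n → Set
π ≤ᴮ σ = ∃[ τ ] Star _reducesTo_ σ τ × τ ≈ π

IsDescent : Permutation′ n → Fin n → Set
IsDescent ω i = ∃[ j ] toℕ j ≡ suc (toℕ i) × ω ⟨$⟩ʳ i Fin.> ω ⟨$⟩ʳ j

HasOneDescent : Permutation′ n → Set
HasOneDescent ω = ∃! _≡_ (IsDescent ω)

record 𝔅 (n : ℕ) : Set where
  constructor mk𝔅
  field
    perm              : Permutation′ n
    oneDescent        : HasOneDescent perm
    oneDescentInverse : HasOneDescent (flip perm)

open 𝔅 public

infix 4 _≼_

_≼_ : 𝔅 n → 𝔅 n → Set
π ≼ σ = perm π ≤ᴮ perm σ

-- Two elements of 𝔅 n are identified when they are the same permutation.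
𝔅-setoid : ℕ → Setoid 0ℓ 0ℓ
𝔅-setoid n = record
  { Carrier       = 𝔅 n
  ; _≈_           = λ π σ → perm π ≈ perm σ
  ; isEquivalence = record
    { refl  = λ _ → refl
    ; sym   = λ p i → sym (p i)
    ; trans = λ p q i → trans (p i) (q i)
    }
  }

subsetoid : (𝔅 n → Set) → Setoid 0ℓ 0ℓ
subsetoid {n} P = On.setoid {B = Σ (𝔅 n) P} (𝔅-setoid n) proj₁

_hasCardinality_ : (𝔅 n → Set) → ℕ → Set
P hasCardinality k = Inverse (setoid (Fin k)) (subsetoid P)

-- β and α are given by their graphs; the k is unique because Fin k and Fin k′
-- are in bijection only when k = k′.
β[_]≐_ : 𝔅 n → ℕ → Set
β[ σ ]≐ k = (λ π → π ≼ σ) hasCardinality k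

α[_]≐_ : 𝔅 n → ℕ → Set
α[ σ ]≐ k = (λ τ → σ ≼ τ) hasCardinality k

record LengthVector (n : ℕ) : Set where
  constructor mkLV
  field
    ℓ₁ ℓ₂ ℓ₃ ℓ₄ : ℕ
    ℓ₁>0 : ℓ₁ > 0
    ℓ₂>0 : ℓ₂ > 0
    ℓ₃>0 : ℓ₃ > 0
    ℓ₄>0 : ℓ₄ > 0
    sum≡ : ℓ₁ + ℓ₂ + ℓ₃ + ℓ₄ ≡ n + 2

-- The graph of 1⋯a (b+1)⋯c (a+1)⋯b (c+1)⋯n, shifted down by one, where
-- b = a + p and c = a + p + q: "x ↦ y" is BlockSwap a p q x y.
data BlockSwap (a p q x y : ℕ) : Set where
  block₁ : x < a → y ≡ x → BlockSwap a p q x y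
  block₂ : ∀ k → k < q → x ≡ a + k → y ≡ a + p + k → BlockSwap a p q x y
  block₃ : ∀ k → k < p → x ≡ a + q + k → y ≡ a + k → BlockSwap a p q x y
  block₄ : a + p + q ≤ x → y ≡ x → BlockSwap a p q x y

_HasLengthVector_ : Permutation′ n → LengthVector n → Set
ω HasLengthVector ℓ =
  ∀ i → BlockSwap (pred ℓ₁) ℓ₂ ℓ₃ (toℕ i) (toℕ (ω ⟨$⟩ʳ i))
  where open LengthVector ℓ

module _ {a p q : ℕ} where

  swap-sym : ∀ {x y} → BlockSwap a p q x y → BlockSwap a q p y x
  swap-sym (block₁ x<a refl)   = block₁ x<a refl
  swap-sym (block₂ k k<q e e′) = block₃ k k<q e′ e
  swap-sym (block₃ k k<p e e′) = block₂ k k<p e′ e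
  swap-sym {x} (block₄ c≤x refl) = block₄ (subst (_≤ x) (comm a p q) c≤x) refl
    where
    comm : ∀ a p q → a + p + q ≡ a + q + p
    comm = solve-∀

  swap-total : ∀ x → ∃ (BlockSwap a p q x)
  swap-total x with x <? a
  ... | yes x<a = x , block₁ x<a refl
  ... | no  x≮a with m≤n⇒∃[o]m+o≡n (≮⇒≥ x≮a)
  ... | k , refl with k <? q
  ... | yes k<q = a + p + k , block₂ k k<q refl refl
  ... | no  k≮q with m≤n⇒∃[o]m+o≡n (≮⇒≥ k≮q)
  ... | l , refl with l <? p
  ... | yes l<p = a + l , block₃ l l<p (sym (+-assoc a q l)) refl
  ... | no  l≮p = a + (q + l) , block₄ c≤ refl
    where
    c≤ : a + p + q ≤ a + (q + l)
    c≤ = begin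
      a + p + q    ≡⟨ +-assoc a p q ⟩
      a + (p + q)  ≡⟨ cong (a +_) (+-comm p q) ⟩
      a + (q + p)  ≤⟨ +-monoʳ-≤ a (+-monoʳ-≤ q (≮⇒≥ l≮p)) ⟩
      a + (q + l)  ∎
      where open ≤-Reasoning

  -- Away from the junction of blocks 2 and 3 the entries increase.
  swap-step : p > 0 → q > 0 → ∀ {x v w} → suc x ≢ a + q →
              BlockSwap a p q x v → BlockSwap a p q (suc x) w → v < w
  swap-step p>0 q>0 {x} ne (block₁ x<a refl) (block₁ _ refl) = ≤-refl
  swap-step p>0 q>0 {x} ne (block₁ x<a refl) (block₂ k _ e refl) = begin
    suc x      ≡⟨ e ⟩
    a + k      ≤⟨ +-monoˡ-≤ k (m≤m+n a p) ⟩
    a + p + k  ∎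
    where open ≤-Reasoning
  swap-step p>0 q>0 {x} ne (block₁ x<a refl) (block₃ k _ e refl) =
    contradiction x<a (<⇒≱ (begin
      suc a      ≡⟨ +-comm 1 a ⟩
      a + 1      ≤⟨ +-monoʳ-≤ a q>0 ⟩
      a + q      ≤⟨ m≤m+n (a + q) k ⟩
      a + q + k  ≡⟨ e ⟨
      suc x      ∎))
    where open ≤-Reasoning
  swap-step p>0 q>0 {x} ne (block₁ x<a refl) (block₄ _ refl) = ≤-refl
  swap-step p>0 q>0 {x} ne (block₂ k k<q refl refl) (block₁ lt _) =
    contradiction (<-trans (n<1+n _) lt) (m+n≮m a k)
  swap-step p>0 q>0 {x} ne (block₂ k k<q refl refl) (block₂ k′ _ e refl) =
    +-monoʳ-< (a + p) (+-cancelˡ-≤ a (suc k) k′ (≤-reflexive (trans (+-suc a k) e)))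
  swap-step p>0 q>0 {x} ne (block₂ k k<q refl refl) (block₃ k′ _ e refl) =
    contradiction (≤-antisym
      (begin
        suc (a + k)  ≡⟨ +-suc a k ⟨
        a + suc k    ≤⟨ +-monoʳ-≤ a k<q ⟩
        a + q        ∎)
      (begin
        a + q        ≤⟨ m≤m+n (a + q) k′ ⟩
        a + q + k′   ≡⟨ e ⟨
        suc (a + k)  ∎)) ne
    where open ≤-Reasoning
  swap-step p>0 q>0 {x} ne (block₂ k k<q refl refl) (block₄ le _) =
    contradiction le (<⇒≱ (begin
      2 + (a + k)      ≡⟨ lem a k ⟩
      a + 1 + (1 + k)  ≤⟨ +-mono-≤ (+-monoʳ-≤ a p>0) k<q ⟩
      a + p + q        ∎))
    where
    open ≤-Reasoning
    lem : ∀ a k → 2 + (a + k) ≡ a + 1 + (1 + k)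
    lem = solve-∀
  swap-step p>0 q>0 {x} ne (block₃ k k<p refl refl) (block₁ lt _) =
    contradiction (<-trans (n<1+n _) lt)
      (≤⇒≯ (≤-trans (m≤m+n a q) (m≤m+n (a + q) k)))
  swap-step p>0 q>0 {x} ne (block₃ k k<p refl refl) (block₂ k′ k′<q e _) =
    contradiction (+-monoʳ-< a k′<q) (≤⇒≯ (begin
      a + q            ≤⟨ m≤m+n (a + q) k ⟩
      a + q + k        ≤⟨ n≤1+n _ ⟩
      suc (a + q + k)  ≡⟨ e ⟩
      a + k′           ∎))
    where open ≤-Reasoning
  swap-step p>0 q>0 {x} ne (block₃ k k<p refl refl) (block₃ k′ _ e refl) =
    +-monoʳ-< a (+-cancelˡ-≤ (a + q) (suc k) k′ (≤-reflexive (trans (+-suc (a + q) k) e)))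
  swap-step p>0 q>0 {x} ne (block₃ k k<p refl refl) (block₄ _ refl) =
    s≤s (+-monoˡ-≤ k (m≤m+n a q))
  swap-step p>0 q>0 {x} ne (block₄ le refl) (block₁ lt _) =
    contradiction (<-trans (n<1+n _) lt)
      (≤⇒≯ (≤-trans (≤-trans (m≤m+n a p) (m≤m+n (a + p) q)) le))
  swap-step p>0 q>0 {x} ne (block₄ le refl) (block₂ k k<q e _) =
    contradiction (+-monoʳ-< a k<q) (≤⇒≯ (begin
      a + q      ≤⟨ +-monoˡ-≤ q (m≤m+n a p) ⟩
      a + p + q  ≤⟨ le ⟩
      x          ≤⟨ n≤1+n x ⟩
      suc x      ≡⟨ e ⟩
      a + k      ∎))
    where open ≤-Reasoning
  swap-step p>0 q>0 {x} ne (block₄ le refl) (block₃ k k<p e _) =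
    contradiction (+-monoʳ-< (a + q) k<p) (≤⇒≯ (begin
      a + q + p  ≡⟨ lem a q p ⟩
      a + p + q  ≤⟨ le ⟩
      x          ≤⟨ n≤1+n x ⟩
      suc x      ≡⟨ e ⟩
      a + q + k  ∎))
    where
    open ≤-Reasoning
    lem : ∀ a q p → a + q + p ≡ a + p + q
    lem = solve-∀
  swap-step p>0 q>0 {x} ne (block₄ le refl) (block₄ _ refl) = ≤-refl

  swap-bound : ∀ {x y} → a + p + q ≤ n → x < n → BlockSwap a p q x y → y < n
  swap-bound c≤n x<n (block₁ _ refl)       = x<n
  swap-bound c≤n x<n (block₂ k k<q _ refl) =
    <-≤-trans (+-monoʳ-< (a + p) k<q) c≤n
  swap-bound c≤n x<n (block₃ k k<p _ refl) =
    <-≤-trans (+-monoʳ-< a k<p) (≤-trans (m≤m+n (a + p) q) c≤n)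
  swap-bound c≤n x<n (block₄ _ refl)       = x<n

module _ {a p q : ℕ} where

  private
    zone₁ : ∀ {x y} → BlockSwap a p q x y → x < a → y ≡ x
    zone₁ (block₁ _ e) x<a = e
    zone₁ (block₂ k _ refl _) x<a = contradiction x<a (m+n≮m a k)
    zone₁ (block₃ k _ refl _) x<a =
      contradiction x<a (≤⇒≯ (≤-trans (m≤m+n a q) (m≤m+n (a + q) k)))
    zone₁ (block₄ _ e) x<a = e

    zone₂ : ∀ {x y} → BlockSwap a p q x y → ∀ k → k < q → x ≡ a + k → y ≡ a + p + k
    zone₂ (block₁ x<a _) k k<q refl = contradiction x<a (m+n≮m a k)
    zone₂ (block₂ k′ _ e e′) k k<q refl with +-cancelˡ-≡ a k k′ e
    ... | refl = e′
    zone₂ (block₃ k′ _ e _) k k<q refl =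
      contradiction (+-monoʳ-< a k<q)
        (≤⇒≯ (≤-trans (m≤m+n (a + q) k′) (≤-reflexive (sym e))))
    zone₂ (block₄ le _) k k<q refl =
      contradiction (+-monoʳ-< a k<q) (≤⇒≯ (≤-trans (+-monoˡ-≤ q (m≤m+n a p)) le))

  swap-functional : ∀ {x y z} → BlockSwap a p q x y → BlockSwap a p q x z → y ≡ z
  swap-functional (block₁ x<a refl) t = sym (zone₁ t x<a)
  swap-functional (block₂ k k<q e refl) t = sym (zone₂ t k k<q e)
  swap-functional s@(block₃ _ _ _ _) (block₁ x<a refl) = zone₁ s x<a
  swap-functional s@(block₃ _ _ _ _) (block₂ k k<q e refl) = zone₂ s k k<q e
  swap-functional (block₃ k _ refl refl) (block₃ k′ _ e refl) =
    cong (a +_) (+-cancelˡ-≡ (a + q) k k′ e)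
  swap-functional (block₃ k k<p refl refl) (block₄ le refl) =
    contradiction le (<⇒≱ (subst (a + q + k <_) (lem a q p) (+-monoʳ-< (a + q) k<p)))
    where
    lem : ∀ a q p → a + q + p ≡ a + p + q
    lem = solve-∀
  swap-functional s@(block₄ _ _) (block₁ x<a refl) = zone₁ s x<a
  swap-functional s@(block₄ _ _) (block₂ k k<q e refl) = zone₂ s k k<q e
  swap-functional (block₄ le refl) (block₃ k k<p refl refl) =
    contradiction le (<⇒≱ (subst (a + q + k <_) (lem a q p) (+-monoʳ-< (a + q) k<p)))
    where
    lem : ∀ a q p → a + q + p ≡ a + p + q
    lem = solve-∀
  swap-functional (block₄ _ refl) (block₄ _ refl) = refl

-- A permutation whose graph is a nondegenerate block swap has one descent.
swap-oneDescent : ∀ {a p q} → p > 0 → q > 0 → a + p + q ≤ n → (ω : Permutation′ n) →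
  (∀ i → BlockSwap a p q (toℕ i) (toℕ (ω ⟨$⟩ʳ i))) → HasOneDescent ω
swap-oneDescent {n} {a} {p} {suc q} p>0 q>0 c≤n ω graph =
  i , (j , j≡1+i , ωj<ωi) , unique
  where
  open ≤-Reasoning

  j<n : a + suc q < n
  j<n = begin-strict
    a + suc q      ≡⟨ +-identityʳ _ ⟨
    a + suc q + 0  <⟨ +-monoʳ-< (a + suc q) p>0 ⟩
    a + suc q + p  ≡⟨ lem a (suc q) p ⟩
    a + p + suc q  ≤⟨ c≤n ⟩
    n              ∎
    where
    lem : ∀ a q p → a + q + p ≡ a + p + q
    lem = solve-∀

  i<n : a + q < n
  i<n = <-trans (+-monoʳ-< a (n<1+n q)) j<n

  i j : Fin n
  i = fromℕ< i<n
  j = fromℕ< j<n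

  toℕ-i : toℕ i ≡ a + q
  toℕ-i = toℕ-fromℕ< i<n

  toℕ-j : toℕ j ≡ a + suc q
  toℕ-j = toℕ-fromℕ< j<n

  j≡1+i : toℕ j ≡ suc (toℕ i)
  j≡1+i = trans toℕ-j (trans (+-suc a q) (cong suc (sym toℕ-i)))

  ωi≡ : toℕ (ω ⟨$⟩ʳ i) ≡ a + p + q
  ωi≡ = swap-functional (graph i) (block₂ q (n<1+n q) toℕ-i refl)

  ωj≡ : toℕ (ω ⟨$⟩ʳ j) ≡ a + 0
  ωj≡ = swap-functional (graph j)
    (block₃ 0 p>0 (trans toℕ-j (sym (+-identityʳ _))) refl)

  ωj<ωi : toℕ (ω ⟨$⟩ʳ j) < toℕ (ω ⟨$⟩ʳ i)
  ωj<ωi = begin-strict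
    toℕ (ω ⟨$⟩ʳ j)  ≡⟨ ωj≡ ⟩
    a + 0           <⟨ +-monoʳ-< a p>0 ⟩
    a + p           ≤⟨ m≤m+n (a + p) q ⟩
    a + p + q       ≡⟨ ωi≡ ⟨
    toℕ (ω ⟨$⟩ʳ i)  ∎

  unique : ∀ {y} → IsDescent ω y → i ≡ y
  unique {y} (z , z≡1+y , ωz<ωy) with suc (toℕ y) ≟ a + suc q
  ... | yes e = toℕ-injective (trans toℕ-i (suc-injective (trans (sym (+-suc a q)) (sym e))))
  ... | no ne = contradiction ωz<ωy (<⇒≯ (swap-step p>0 q>0 ne (graph y)
                 (subst (λ u → BlockSwap a p (suc q) u (toℕ (ω ⟨$⟩ʳ z))) z≡1+y (graph z))))

module FromLengthVector {n : ℕ} (ℓ : LengthVector n) where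
  open LengthVector ℓ

  c≤n : pred ℓ₁ + ℓ₂ + ℓ₃ ≤ n
  c≤n = go ℓ₁>0 ℓ₄>0 sum≡
    where
    lem₁ : ∀ a p q → suc a + p + q + 1 ≡ (a + p + q) + 2
    lem₁ = solve-∀
    open ≤-Reasoning
    go : ∀ {k m} → k > 0 → m > 0 → k + ℓ₂ + ℓ₃ + m ≡ n + 2 → pred k + ℓ₂ + ℓ₃ ≤ n
    go {suc a} {m} _ m>0 e = +-cancelʳ-≤ 2 _ n (begin
      (a + ℓ₂ + ℓ₃) + 2    ≡⟨ lem₁ a ℓ₂ ℓ₃ ⟨
      suc a + ℓ₂ + ℓ₃ + 1  ≤⟨ +-monoʳ-≤ (suc a + ℓ₂ + ℓ₃) m>0 ⟩
      suc a + ℓ₂ + ℓ₃ + m  ≡⟨ e ⟩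
      n + 2                ∎)

  c≤n′ : pred ℓ₁ + ℓ₃ + ℓ₂ ≤ n
  c≤n′ = subst (_≤ n) (lem (pred ℓ₁) ℓ₂ ℓ₃) c≤n
    where
    lem : ∀ a p q → a + p + q ≡ a + q + p
    lem = solve-∀

  module Apply {p q} (c≤n : pred ℓ₁ + p + q ≤ n) (i : Fin n) where
    private
      y    = swap-total {pred ℓ₁} {p} {q} (toℕ i)
      y<n  = swap-bound c≤n (toℕ<n i) (proj₂ y)

    image : Fin n
    image = fromℕ< y<n

    graph : BlockSwap (pred ℓ₁) p q (toℕ i) (toℕ image)
    graph = subst (BlockSwap _ p q _) (sym (toℕ-fromℕ< y<n)) (proj₂ y)

  open Apply

  permOf : Permutation′ n
  permOf = permutation (image c≤n) (image c≤n′)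
    (λ y → toℕ-injective (swap-functional (graph c≤n _) (swap-sym (graph c≤n′ y))))
    (λ x → toℕ-injective (swap-functional (graph c≤n′ _) (swap-sym (graph c≤n x))))

  elementOf : 𝔅 n
  elementOf = mk𝔅 permOf
    (swap-oneDescent ℓ₂>0 ℓ₃>0 c≤n permOf (graph c≤n))
    (swap-oneDescent ℓ₃>0 ℓ₂>0 c≤n′ (flip permOf) (graph c≤n′))

  elementOf-correct : permOf HasLengthVector ℓ
  elementOf-correct = graph c≤n

open FromLengthVector public using (elementOf; elementOf-correct)

-- A permutation with one descent, at position d, is increasing on
-- positions ≤ d and on positions > d.
module OneDescent {n} (ω : Permutation′ n) (desc : HasOneDescent ω) where

  d : ℕ
  d = toℕ (proj₁ desc)

  to : Fin n → ℕ
  to i = toℕ (ω ⟨$⟩ʳ i)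

  SameSide : Fin n → Fin n → Set
  SameSide i j = toℕ j ≤ d ⊎ d < toℕ i

  step : ∀ {i j} → toℕ j ≡ suc (toℕ i) → SameSide i j → to i < to j
  step {i} {j} e side with <-cmp (to i) (to j)
  ... | tri< lt _ _ = lt
  ... | tri≈ _ eq _ = contradiction (trans (cong toℕ i≡j) e) (<⇒≢ (n<1+n _))
    where
    i≡j : i ≡ j
    i≡j = trans (sym (inverseˡ ω)) (trans (cong (ω ⟨$⟩ˡ_) (toℕ-injective eq)) (inverseˡ ω))
  ... | tri> _ _ gt with cong toℕ (proj₂ (proj₂ desc) (j , e , gt)) | side
  ... | d≡i | inj₁ j≤d = contradiction (≤-trans (≤-reflexive (trans (cong suc d≡i) (sym e))) j≤d) (n≮n d)
  ... | d≡i | inj₂ d<i = contradiction d≡i (<⇒≢ d<i)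

  climb′ : ∀ k i j → toℕ j ≡ k + toℕ i → SameSide i j → k + to i ≤ to j
  climb′ zero    i j e side = ≤-reflexive (cong to (toℕ-injective (sym e)))
  climb′ (suc k) i j e side = ≤-trans (s≤s (climb′ k i m e₁ side₁)) (step e₂ side₂)
    where
    m<n : k + toℕ i < n
    m<n = <-trans (subst (k + toℕ i <_) (sym e) (n<1+n _)) (toℕ<n j)
    m : Fin n
    m = fromℕ< m<n
    e₁ : toℕ m ≡ k + toℕ i
    e₁ = toℕ-fromℕ< m<n
    e₂ : toℕ j ≡ suc (toℕ m)
    e₂ = trans e (cong suc (sym e₁))
    split : SameSide i j → SameSide i m × SameSide m j
    split (inj₁ j≤d) = inj₁ (≤-trans (≤-trans (n≤1+n _) (≤-reflexive (sym e₂))) j≤d) , inj₁ j≤d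
    split (inj₂ d<i) = inj₂ d<i , inj₂ (<-≤-trans d<i (≤-trans (m≤n+m (toℕ i) k) (≤-reflexive (sym e₁))))
    side₁ = proj₁ (split side)
    side₂ = proj₂ (split side)

  climb : ∀ i j → toℕ i ≤ toℕ j → SameSide i j → toℕ j + to i ≤ to j + toℕ i
  climb i j i≤j side with m≤n⇒∃[o]m+o≡n i≤j
  ... | k , e = begin
    toℕ j + to i          ≡⟨ cong (_+ to i) e ⟨
    toℕ i + k + to i      ≡⟨ lem (toℕ i) k (to i) ⟩
    (k + to i) + toℕ i    ≤⟨ +-monoˡ-≤ (toℕ i) (climb′ k i j (trans (sym e) (+-comm (toℕ i) k)) side) ⟩
    to j + toℕ i          ∎
    where
    open ≤-Reasoning
    lem : ∀ x k y → x + k + y ≡ (k + y) + x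
    lem = solve-∀

  mono-≤ : ∀ i j → toℕ i ≤ toℕ j → SameSide i j → to i ≤ to j
  mono-≤ i j i≤j side = +-cancelˡ-≤ (toℕ j) _ _ (≤-trans (climb i j i≤j side)
    (≤-trans (+-monoʳ-≤ (to j) i≤j) (≤-reflexive (+-comm (to j) (toℕ j)))))

  mono-< : ∀ i j → toℕ i < toℕ j → SameSide i j → to i < to j
  mono-< i j i<j side = +-cancelˡ-< (toℕ j) _ _ (≤-<-trans (climb i j (<⇒≤ i<j) side)
    (<-≤-trans (+-monoʳ-< (to j) i<j) (≤-reflexive (+-comm (to j) (toℕ j)))))

  atLeast : ∀ i → toℕ i ≤ d → toℕ i ≤ to i
  atLeast i i≤d = begin
    toℕ i            ≤⟨ m≤m+n (toℕ i) (to z) ⟩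
    toℕ i + to z     ≤⟨ climb z i (≤-trans (≤-reflexive toℕ-z) z≤n) (inj₁ i≤d) ⟩
    to i + toℕ z     ≡⟨ trans (cong (to i +_) toℕ-z) (+-identityʳ _) ⟩
    to i             ∎
    where
    open ≤-Reasoning
    z<n : 0 < n
    z<n = ≤-<-trans z≤n (toℕ<n i)
    z : Fin n
    z = fromℕ< z<n
    toℕ-z : toℕ z ≡ 0
    toℕ-z = toℕ-fromℕ< z<n

  atMost : ∀ i → d < toℕ i → to i ≤ toℕ i
  atMost i d<i = +-cancelˡ-≤ (toℕ l) _ _ (≤-trans (climb i l i≤l (inj₂ d<i))
    (+-monoˡ-≤ (toℕ i) (≤-trans (<⇒≤pred (toℕ<n (ω ⟨$⟩ʳ l))) (≤-reflexive (sym toℕ-l)))))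
    where
    pred<n : ∀ {m} → 0 < m → pred m < m
    pred<n {suc m} _ = ≤-refl
    l<n : pred n < n
    l<n = pred<n (≤-<-trans z≤n (toℕ<n i))
    l : Fin n
    l = fromℕ< l<n
    toℕ-l : toℕ l ≡ pred n
    toℕ-l = toℕ-fromℕ< l<n
    i≤l : toℕ i ≤ toℕ l
    i≤l = ≤-trans (<⇒≤pred (toℕ<n i)) (≤-reflexive (sym toℕ-l))

-- With P = ω and V = ω⁻¹, d is the descent position of ω and e that of ω⁻¹.
-- The two descents split positions and values into two sides each; on each of
-- the four resulting parts ω is a translation.
module ToLengthVector {n} (σ : 𝔅 n) where

  private
    ω = perm σ

    module P = OneDescent ω (oneDescent σ)
    module V = OneDescent (flip ω) (oneDescentInverse σ)

    d e : ℕ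
    d = P.d
    e = V.d

    to from : Fin n → ℕ
    to   = P.to
    from = V.to

    from-to : ∀ i → from (ω ⟨$⟩ʳ i) ≡ toℕ i
    from-to i = cong toℕ (inverseˡ ω)

    to-from : ∀ v → to (ω ⟨$⟩ˡ v) ≡ toℕ v
    to-from v = cong toℕ (inverseʳ ω)

    -- Positions d and d + 1; values e and e + 1.
    i₀ j₀ e₀ e₁ : Fin n
    i₀ = proj₁ (oneDescent σ)
    j₀ = proj₁ (proj₁ (proj₂ (oneDescent σ)))
    e₀ = proj₁ (oneDescentInverse σ)
    e₁ = proj₁ (proj₁ (proj₂ (oneDescentInverse σ)))

    j₀≡ : toℕ j₀ ≡ suc d
    j₀≡ = proj₁ (proj₂ (proj₁ (proj₂ (oneDescent σ))))

    e₁≡ : toℕ e₁ ≡ suc e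
    e₁≡ = proj₁ (proj₂ (proj₁ (proj₂ (oneDescentInverse σ))))

    from-e₁<from-e₀ : from e₁ < from e₀
    from-e₁<from-e₀ = proj₂ (proj₂ (proj₁ (proj₂ (oneDescentInverse σ))))

    d<j₀ : d < toℕ j₀
    d<j₀ = ≤-reflexive (sym j₀≡)

    e<e₁ : e < toℕ e₁
    e<e₁ = ≤-reflexive (sym e₁≡)

  a b c p q : ℕ
  a = to j₀
  b = suc e
  c = suc (to i₀)
  p = b ∸ a
  q = c ∸ b

  private
    p₀ : Fin n
    p₀ = ω ⟨$⟩ˡ e₁

    to-p₀ : to p₀ ≡ suc e
    to-p₀ = trans (to-from e₁) e₁≡

    p₀≤d : toℕ p₀ ≤ d
    p₀≤d with toℕ p₀ ≤? d
    ... | yes ≤d = ≤d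
    ... | no ≰d = contradiction
      (subst₂ _<_ (to-from e₁) (to-from e₀)
        (P.mono-< p₀ (ω ⟨$⟩ˡ e₀) from-e₁<from-e₀ (inj₂ (≰⇒> ≰d))))
      (<⇒≯ e<e₁)

    d<from-e₀ : d < from e₀
    d<from-e₀ with from e₀ ≤? d
    ... | no ≰d = ≰⇒> ≰d
    ... | yes ≤d = contradiction
      (subst₂ _<_ (to-from e₁) (to-from e₀)
        (P.mono-< p₀ (ω ⟨$⟩ˡ e₀) from-e₁<from-e₀ (inj₁ ≤d)))
      (<⇒≯ e<e₁)

    e<to-i₀ : e < to i₀
    e<to-i₀ = ≤-trans (≤-reflexive (sym to-p₀)) (P.mono-≤ p₀ i₀ p₀≤d (inj₁ ≤-refl))

    a≤e : a ≤ e
    a≤e = ≤-trans (P.mono-≤ j₀ (ω ⟨$⟩ˡ e₀) (≤-trans (≤-reflexive j₀≡) d<from-e₀) (inj₂ d<j₀))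
                  (≤-reflexive (to-from e₀))

    from-a : from (ω ⟨$⟩ʳ j₀) ≡ suc d
    from-a = trans (from-to j₀) j₀≡

    low : ∀ x → toℕ x ≤ d → to x ≤ e → to x ≡ toℕ x
    low x x≤d v≤e = ≤-antisym
      (≤-trans (V.atLeast (ω ⟨$⟩ʳ x) v≤e) (≤-reflexive (from-to x)))
      (P.atLeast x x≤d)

    high : ∀ x → d < toℕ x → e < to x → to x ≡ toℕ x
    high x d<x e<v = ≤-antisym
      (P.atMost x d<x)
      (≤-trans (≤-reflexive (sym (from-to x))) (V.atMost (ω ⟨$⟩ʳ x) e<v))

    translate-≤ : ∀ x y → toℕ x ≤ toℕ y → P.SameSide x y →
                  to y ≤ e ⊎ e < to x → toℕ y + to x ≡ to y + toℕ x
    translate-≤ x y x≤y s t = ≤-antisym (P.climb x y x≤y s)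
      (≤-trans (≤-reflexive (cong (to y +_) (sym (from-to x))))
        (≤-trans (V.climb (ω ⟨$⟩ʳ x) (ω ⟨$⟩ʳ y) (P.mono-≤ x y x≤y s) t)
          (≤-reflexive (cong (_+ to x) (from-to y)))))

    translate₂ : ∀ x y → toℕ x ≤ d → toℕ y ≤ d → e < to x → e < to y →
                 toℕ y + to x ≡ to y + toℕ x
    translate₂ x y x≤d y≤d e<x e<y with ≤-total (toℕ x) (toℕ y)
    ... | inj₁ x≤y = translate-≤ x y x≤y (inj₁ y≤d) (inj₂ e<x)
    ... | inj₂ y≤x = trans (+-comm (toℕ y) (to x))
      (trans (sym (translate-≤ y x y≤x (inj₁ x≤d) (inj₂ e<y))) (+-comm (toℕ x) (to y)))

    a≤p₀ : a ≤ toℕ p₀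
    a≤p₀ with a ≤? toℕ p₀
    ... | yes a≤ = a≤
    ... | no a≰ = contradiction p₀≤e (<⇒≱ (≤-reflexive (trans (sym to-p₀) (trans (sym (cong to q₀≡p₀)) (to-from p₀)))))
      where
      p₀<a : toℕ p₀ < a
      p₀<a = ≰⇒> a≰
      p₀≤e : toℕ p₀ ≤ e
      p₀≤e = ≤-trans (<⇒≤ p₀<a) a≤e
      q₀ : Fin n
      q₀ = ω ⟨$⟩ˡ p₀
      q₀≤d : toℕ q₀ ≤ d
      q₀≤d = s≤s⁻¹ (<-≤-trans (V.mono-< p₀ (ω ⟨$⟩ʳ j₀) p₀<a (inj₁ a≤e)) (≤-reflexive from-a))
      q₀≡p₀ : q₀ ≡ p₀
      q₀≡p₀ = toℕ-injective (trans (sym (low q₀ q₀≤d (≤-trans (≤-reflexive (to-from p₀)) p₀≤e))) (to-from p₀))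

    -- If p₀ were larger than a, position a would hold a value below e + 1.
    p₀≡a : toℕ p₀ ≡ a
    p₀≡a with m≤n⇒m<n∨m≡n a≤p₀
    ... | inj₂ a≡p₀ = sym a≡p₀
    ... | inj₁ a<p₀ = contradiction (trans (sym A≡a) (cong toℕ A≡j₀))
                        (<⇒≢ (≤-<-trans (≤-trans a≤p₀ p₀≤d) d<j₀))
      where
      A : Fin n
      A = ω ⟨$⟩ʳ j₀
      A<p₀ : toℕ A < toℕ p₀
      A<p₀ = a<p₀
      to-A≤e : to A ≤ e
      to-A≤e = s≤s⁻¹ (<-≤-trans (P.mono-< A p₀ A<p₀ (inj₁ p₀≤d)) (≤-reflexive to-p₀))
      A≡a : toℕ A ≡ a
      A≡a = refl
      A≡j₀ : A ≡ j₀
      A≡j₀ = trans (sym (inverseˡ ω)) (trans (cong (ω ⟨$⟩ˡ_) ωA≡A) (inverseˡ ω))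
        where
        ωA≡A : ω ⟨$⟩ʳ A ≡ ω ⟨$⟩ʳ j₀
        ωA≡A = toℕ-injective (low A (≤-trans a≤p₀ p₀≤d) to-A≤e)

  a<b : a < b
  a<b = s≤s a≤e

  b<c : b < c
  b<c = s≤s e<to-i₀

  c≤n : c ≤ n
  c≤n = toℕ<n (ω ⟨$⟩ʳ i₀)

  a+p≡b : a + p ≡ b
  a+p≡b = m+[n∸m]≡n (<⇒≤ a<b)

  b+q≡c : b + q ≡ c
  b+q≡c = m+[n∸m]≡n (<⇒≤ b<c)

  a+p+q≡c : a + p + q ≡ c
  a+p+q≡c = trans (cong (_+ q) a+p≡b) b+q≡c

  private
    a+q≡1+d : a + q ≡ suc d
    a+q≡1+d = +-cancelʳ-≡ b (a + q) (suc d) (begin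
      a + q + b          ≡⟨ lem a q b ⟩
      (b + q) + a        ≡⟨ cong (_+ a) b+q≡c ⟩
      suc (to i₀) + a    ≡⟨ cong (suc (to i₀) +_) p₀≡a ⟨
      suc (to i₀ + toℕ p₀)  ≡⟨ cong suc (translate₂ p₀ i₀ p₀≤d ≤-refl (≤-reflexive (sym to-p₀)) e<to-i₀) ⟨
      suc (d + to p₀)    ≡⟨ cong (λ u → suc (d + u)) to-p₀ ⟩
      suc d + b          ∎)
      where
      open ≡-Reasoning
      lem : ∀ a q b → a + q + b ≡ (b + q) + a
      lem = solve-∀

  graph : ∀ x → BlockSwap a p q (toℕ x) (to x)
  graph x with toℕ x ≤? d | to x ≤? e
  ... | yes x≤d | yes v≤e = block₁ x<a (low x x≤d v≤e)
    where
    x<a : toℕ x < a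
    x<a with toℕ x <? a
    ... | yes lt = lt
    ... | no ≮ = contradiction
      (≤-trans (≤-reflexive (sym from-a))
        (≤-trans (V.mono-≤ (ω ⟨$⟩ʳ j₀) (ω ⟨$⟩ʳ x)
                   (≤-trans (≮⇒≥ ≮) (≤-reflexive (sym (low x x≤d v≤e)))) (inj₁ v≤e))
          (≤-reflexive (from-to x))))
      (≤⇒≯ x≤d)
  ... | yes x≤d | no v≰e with m≤n⇒∃[o]m+o≡n (≰⇒> v≰e)
  ...   | k , b+k≡v = block₂ k k<q x≡a+k (trans (sym b+k≡v) (cong (_+ k) (sym a+p≡b)))
    where
    x≡a+k : toℕ x ≡ a + k
    x≡a+k = +-cancelʳ-≡ b (toℕ x) (a + k) (begin
      toℕ x + b      ≡⟨ cong (toℕ x +_) to-p₀ ⟨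
      toℕ x + to p₀  ≡⟨ translate₂ p₀ x p₀≤d x≤d (≤-reflexive (sym to-p₀)) (≰⇒> v≰e) ⟩
      to x + toℕ p₀  ≡⟨ cong₂ _+_ (sym b+k≡v) p₀≡a ⟩
      b + k + a      ≡⟨ lem b k a ⟩
      a + k + b      ∎)
      where
      open ≡-Reasoning
      lem : ∀ b k a → b + k + a ≡ a + k + b
      lem = solve-∀
    k<q : k < q
    k<q = +-cancelˡ-< a k q (subst₂ _<_ x≡a+k (sym a+q≡1+d) (s≤s x≤d))
  graph x | no x≰d | yes v≤e with m≤n⇒∃[o]m+o≡n (≰⇒> x≰d)
  ... | k , 1+d+k≡x = block₃ k k<p (trans (sym 1+d+k≡x) (cong (_+ k) (sym a+q≡1+d))) v≡a+k
    where
    v≡a+k : to x ≡ a + k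
    v≡a+k = +-cancelʳ-≡ (suc d) (to x) (a + k) (begin
      to x + suc d    ≡⟨ cong (to x +_) j₀≡ ⟨
      to x + toℕ j₀   ≡⟨ translate-≤ j₀ x (≤-trans (≤-reflexive j₀≡) (≰⇒> x≰d)) (inj₂ d<j₀) (inj₁ v≤e) ⟨
      toℕ x + a       ≡⟨ cong (_+ a) 1+d+k≡x ⟨
      suc d + k + a   ≡⟨ lem (suc d) k a ⟩
      a + k + suc d   ∎)
      where
      open ≡-Reasoning
      lem : ∀ b k a → b + k + a ≡ a + k + b
      lem = solve-∀
    k<p : k < p
    k<p = +-cancelˡ-< a k p (subst₂ _<_ v≡a+k (sym a+p≡b) (s≤s v≤e))
  graph x | no x≰d | no v≰e =
    block₄ (≤-trans (≤-reflexive a+p+q≡c) c≤x) (high x (≰⇒> x≰d) (≰⇒> v≰e))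
    where
    c≤x : c ≤ toℕ x
    c≤x with to x ≤? to i₀
    ... | no ≰ = ≤-trans (≰⇒> ≰) (≤-reflexive (high x (≰⇒> x≰d) (≰⇒> v≰e)))
    ... | yes v≤ = contradiction
      (subst₂ _≤_ (from-to x) (from-to i₀)
        (V.mono-≤ (ω ⟨$⟩ʳ x) (ω ⟨$⟩ʳ i₀) v≤ (inj₂ (≰⇒> v≰e))))
      x≰d

  lengthVector : LengthVector n
  lengthVector = record
    { ℓ₁ = suc a
    ; ℓ₂ = b ∸ a
    ; ℓ₃ = c ∸ b
    ; ℓ₄ = suc n ∸ c
    ; ℓ₁>0 = z<s
    ; ℓ₂>0 = m<n⇒0<n∸m a<b
    ; ℓ₃>0 = m<n⇒0<n∸m b<c
    ; ℓ₄>0 = m<n⇒0<n∸m (s≤s c≤n)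
    ; sum≡ = begin
        suc (a + p + q) + (suc n ∸ c)  ≡⟨ cong (λ u → suc u + (suc n ∸ c)) a+p+q≡c ⟩
        suc (c + (suc n ∸ c))          ≡⟨ cong suc (m+[n∸m]≡n (≤-trans c≤n (n≤1+n n))) ⟩
        2 + n                          ≡⟨ +-comm 2 n ⟩
        n + 2                          ∎
    }
    where open ≡-Reasoning

  lengthVector-correct : perm σ HasLengthVector lengthVector
  lengthVector-correct = graph

open ToLengthVector public using (lengthVector; lengthVector-correct)

swap₂₁₄₃ : LengthVector n → LengthVector n
swap₂₁₄₃ ℓ = record
  { ℓ₁ = ℓ₂ ; ℓ₂ = ℓ₁ ; ℓ₃ = ℓ₄ ; ℓ₄ = ℓ₃
  ; ℓ₁>0 = ℓ₂>0 ; ℓ₂>0 = ℓ₁>0 ; ℓ₃>0 = ℓ₄>0 ; ℓ₄>0 = ℓ₃>0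
  ; sum≡ = trans (lem ℓ₁ ℓ₂ ℓ₃ ℓ₄) sum≡
  }
  where
  open LengthVector ℓ
  lem : ∀ w x y z → x + w + z + y ≡ w + x + y + z
  lem = solve-∀

f₂₁₄₃ : 𝔅 n → 𝔅 n
f₂₁₄₃ σ = elementOf (swap₂₁₄₃ (lengthVector σ))

{-# OPTIONS --safe #-}
-- Write a block swap as (a, p, q), where p = ℓ₂ and q = ℓ₃ and the block
-- starts at a = ℓ₁ − 1.  Then (a, p, q) ≤ (a′, p′, q′) in the Bruhat order iff
-- a′ ≤ a, p ≤ p′, q ≤ q′ and a + p + q ≤ a′ + p′ + q′, that is, iff ℓ₁ and ℓ₄
-- do not decrease and ℓ₂ and ℓ₃ do not increase going down; so the map 2143
-- reverses the order.  Necessity: reductions do not increase the number of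
-- x < i with σ(x) ≥ j, nor that of x ≥ i with σ(x) < j; compare at i = a + q,
-- j = a + p.  Sufficiency: moving one entry past a block turns (a, p, q + 1)
-- into (a + 1, p, q) or (a, p, q), and inverses give the same for p.  Thus
-- β(σ) = Σ (u + v + 1) over u < ℓ₂ and v < ℓ₃.
module Submission where

open import Defs
open import Data.Nat.Base using (ℕ; _+_; _*_; _≥_)
open import Data.Product.Base using (_×_; ∃-syntax)
open import Function.Bundles using (_⇔_)
open import Relation.Binary.PropositionalEquality using (_≡_)

open import Data.Fin.Base as Fin using (Fin; zero; suc; toℕ; fromℕ<)
open import Data.Fin.Permutation
  using (Permutation′; _⟨$⟩ʳ_; _⟨$⟩ˡ_; _≈_; _∘ₚ_; transpose; flip; inverseˡ; inverseʳ)
open import Data.Fin.Properties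
  using (_≟_; toℕ-injective; toℕ<n; toℕ-fromℕ<; injective⇒≤; +↔⊎)
open import Data.Nat.Base hiding (ℕ; _+_; _*_; _≥_)
open import Data.Nat.Properties hiding (_≟_)
open import Data.Nat.Tactic.RingSolver using (solve-∀)
open import Data.Product.Base using (Σ; ∃; _,_; proj₁; proj₂)
open import Data.Sum.Base using (_⊎_; inj₁; inj₂)
open import Data.Sum.Function.Propositional using (_⊎-↔_)
open import Function.Base using (_∘_; id)
open import Function.Bundles
  using (mk⇔; Injection; Bijection; Equivalence; _↔_; mk↔ₛ′)
import Function.Construct.Composition as Compose
open import Function.Definitions using (Injective)
open import Function.Properties.Bijection using (Bijection⇒Inverse)
open import Function.Properties.Inverse using (↔⇒↣; ↔-trans)
open import Relation.Binary.Construct.Closure.ReflexiveTransitive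
  using (Star; ε; _◅_; _◅◅_; gmap)
open import Relation.Binary.Definitions using (tri<; tri≈; tri>)
open import Relation.Binary.PropositionalEquality hiding (_≡_)
open import Relation.Nullary using (yes; no; contradiction)

open import Algebra.Properties.CommutativeMonoid.Sum +-0-commutativeMonoid
  using (sum; sum-cong-≗)

open Equivalence using () renaming (to to forth; from to back)
open LengthVector using (ℓ₁>0; ℓ₂>0; ℓ₃>0; ℓ₄>0; sum≡)
  renaming (ℓ₁ to len₁; ℓ₂ to len₂; ℓ₃ to len₃; ℓ₄ to len₄)

private
  variable
    n a p q a′ p′ q′ : ℕ

-- Transpositions, and rank domination as a consequence of the Bruhat order.

perm-injective : (ω : Permutation′ n) → Injective _≡_ _≡_ (ω ⟨$⟩ʳ_)
perm-injective ω = Injection.injective (↔⇒↣ ω)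

-- A transposition given by its graph, so that one match yields the three cases and the relation can
-- be inverted or carried along a permutation.
data Transposed (i j : Fin n) : Fin n → Fin n → Set where
  left  : Transposed i j i j
  right : Transposed i j j i
  fixed : ∀ {x} → x ≢ i → x ≢ j → Transposed i j x x

transposed : (i j x : Fin n) → Transposed i j x (transpose i j ⟨$⟩ʳ x)
transposed i j x with x ≟ i
... | yes refl = left
... | no x≢i with x ≟ j
...   | yes refl = right
...   | no x≢j = fixed x≢i x≢j

-- Rank domination: {x < i : τ x ≥ j} injects into {x < i : σ x ≥ j}, and
-- likewise for the complementary quadrant, through a single injection.
record _⊑_ {n} (τ σ : Permutation′ n) : Set where
  constructor embedding
  field
    embed : ∀ i j → ∃ λ (g : Fin n → Fin n) → Injective _≡_ _≡_ g
      × (∀ x → toℕ x < i → j ≤ toℕ (τ ⟨$⟩ʳ x) → toℕ (g x) < i × j ≤ toℕ (σ ⟨$⟩ʳ g x))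
      × (∀ x → i ≤ toℕ x → toℕ (τ ⟨$⟩ʳ x) < j → i ≤ toℕ (g x) × toℕ (σ ⟨$⟩ʳ g x) < j)

open _⊑_

⊑-reflexive : {τ σ : Permutation′ n} → τ ≈ σ → τ ⊑ σ
⊑-reflexive τ≈σ = embedding λ i j → id , id
  , (λ x x<i j≤τx → x<i , subst (j ≤_) (cong toℕ (τ≈σ x)) j≤τx)
  , (λ x i≤x τx<j → i≤x , subst (_< j) (cong toℕ (τ≈σ x)) τx<j)

⊑-trans : {ρ τ σ : Permutation′ n} → ρ ⊑ τ → τ ⊑ σ → ρ ⊑ σ
⊑-trans ρ⊑τ τ⊑σ = embedding λ i j →
  let f , f-inj , f-up , f-down = embed ρ⊑τ i j
      g , g-inj , g-up , g-down = embed τ⊑σ i j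
  in g ∘ f , f-inj ∘ g-inj
  , (λ x x<i j≤ρx → let fx<i , j≤τfx = f-up x x<i j≤ρx in g-up (f x) fx<i j≤τfx)
  , (λ x i≤x ρx<j → let i≤fx , τfx<j = f-down x i≤x ρx<j in g-down (f x) i≤fx τfx<j)

-- If the cut `i` has `k` and `l` on the same side, the transposition itself respects the cut and
-- carries each value along. If it separates them, the identity works: `σ` has the larger of the two
-- values on the left, the smaller on the right.
reduction-⊑ : {σ τ : Permutation′ n} → σ reducesTo τ → τ ⊑ σ
reduction-⊑ {n} {σ} {τ} (k , l , k<l , σk>σl , τ≈) = ⊑-trans (⊑-reflexive τ≈) swapped
  where
  t : Fin n → Fin n
  t = transpose k l ⟨$⟩ʳ_

  t-inj : Injective _≡_ _≡_ t
  t-inj = perm-injective (transpose k l)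

  swapped : (transpose k l ∘ₚ σ) ⊑ σ
  embed swapped i j with toℕ k <? i | toℕ l <? i
  ... | no k≮i | _ = t , t-inj
    , (λ x x<i j≤ → <-side x x<i , j≤)
    , (λ x i≤x <j → ≤-side x i≤x , <j)
    where
    i≤l : i ≤ toℕ l
    i≤l = ≤-trans (≮⇒≥ k≮i) (<⇒≤ k<l)
    <-side : ∀ x → toℕ x < i → toℕ (t x) < i
    <-side x x<i with t x | transposed k l x
    ... | _ | left      = contradiction x<i k≮i
    ... | _ | right     = contradiction x<i (≤⇒≯ i≤l)
    ... | _ | fixed _ _ = x<i
    ≤-side : ∀ x → i ≤ toℕ x → i ≤ toℕ (t x)
    ≤-side x i≤x with t x | transposed k l x
    ... | _ | left      = i≤l
    ... | _ | right     = ≮⇒≥ k≮i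
    ... | _ | fixed _ _ = i≤x
  ... | yes k<i | yes l<i = t , t-inj
    , (λ x x<i j≤ → <-side x x<i , j≤)
    , (λ x i≤x <j → ≤-side x i≤x , <j)
    where
    <-side : ∀ x → toℕ x < i → toℕ (t x) < i
    <-side x x<i with t x | transposed k l x
    ... | _ | left      = l<i
    ... | _ | right     = k<i
    ... | _ | fixed _ _ = x<i
    ≤-side : ∀ x → i ≤ toℕ x → i ≤ toℕ (t x)
    ≤-side x i≤x with t x | transposed k l x
    ... | _ | left      = contradiction k<i (≤⇒≯ i≤x)
    ... | _ | right     = contradiction l<i (≤⇒≯ i≤x)
    ... | _ | fixed _ _ = i≤x
  ... | yes k<i | no l≮i = id , id
    , (λ x x<i j≤ → x<i , raise x x<i j≤)
    , (λ x i≤x <j → i≤x , lower x i≤x <j)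
    where
    raise : ∀ x → toℕ x < i → j ≤ toℕ (σ ⟨$⟩ʳ t x) → j ≤ toℕ (σ ⟨$⟩ʳ x)
    raise x x<i j≤ with t x | transposed k l x
    ... | _ | left      = ≤-trans j≤ (<⇒≤ σk>σl)
    ... | _ | right     = contradiction x<i l≮i
    ... | _ | fixed _ _ = j≤
    lower : ∀ x → i ≤ toℕ x → toℕ (σ ⟨$⟩ʳ t x) < j → toℕ (σ ⟨$⟩ʳ x) < j
    lower x i≤x <j with t x | transposed k l x
    ... | _ | left      = contradiction k<i (≤⇒≯ i≤x)
    ... | _ | right     = <-trans σk>σl <j
    ... | _ | fixed _ _ = <j

≤ᴮ⇒⊑ : {π σ : Permutation′ n} → π ≤ᴮ σ → π ⊑ σ
≤ᴮ⇒⊑ {π = π} (τ , chain , τ≈π) =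
  ⊑-trans (⊑-reflexive (λ x → sym (τ≈π x))) (descend chain)
  where
  descend : ∀ {σ} → Star _reducesTo_ σ τ → τ ⊑ σ
  descend ε                = ⊑-reflexive (λ _ → refl)
  descend (step ◅ chain) = ⊑-trans (descend chain) (reduction-⊑ step)

-- Necessity: pigeonhole bounds for block swaps.

injection-into-interval : ∀ {m lo hi} (u : Fin m → ℕ) → Injective _≡_ _≡_ u → m > 0 →
  (∀ k → lo ≤ u k × u k < hi) → lo + m ≤ hi
injection-into-interval {m} {lo} {hi} u u-inj m>0 u∈ = begin
  lo + m          ≤⟨ +-monoʳ-≤ lo (injective⇒≤ {f = v} v-inj) ⟩
  lo + (hi ∸ lo)  ≡⟨ m+[n∸m]≡n lo≤hi ⟩
  hi              ∎
  where
  open ≤-Reasoning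

  lo≤hi : lo ≤ hi
  -- A value of `u` witnesses that the interval is nonempty; with `m = 0` nothing would exclude
  -- `hi < lo`.
  lo≤hi with u∈ (fromℕ< m>0)
  ... | lo≤u , u<hi = ≤-trans lo≤u (<⇒≤ u<hi)

  u∸lo<hi∸lo : ∀ k → u k ∸ lo < hi ∸ lo
  u∸lo<hi∸lo k = ∸-monoˡ-< (proj₂ (u∈ k)) (proj₁ (u∈ k))

  v : Fin m → Fin (hi ∸ lo)
  v k = fromℕ< (u∸lo<hi∸lo k)

  v-inj : Injective _≡_ _≡_ v
  v-inj {k} {l} vk≡vl = u-inj (∸-cancelʳ-≡ (proj₁ (u∈ k)) (proj₁ (u∈ l))
    (trans (sym (toℕ-fromℕ< (u∸lo<hi∸lo k)))
      (trans (cong toℕ vk≡vl) (toℕ-fromℕ< (u∸lo<hi∸lo l)))))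

-- Only block 2 raises values, and by exactly `p`. Through `swap-sym` this also gives `x ≤ y + q`.
swap-raise : ∀ {x y} → BlockSwap a p q x y → y ≤ x + p
swap-raise {p = p} (block₁ _ refl) = m≤m+n _ p
swap-raise {a} {p} (block₂ k _ refl refl) = ≤-reflexive (lem a p k)
  where
  lem : ∀ a p k → a + p + k ≡ a + k + p
  lem = solve-∀
swap-raise {a} {p} {q} (block₃ k _ refl refl) =
  ≤-trans (+-monoˡ-≤ k (m≤m+n a q)) (m≤m+n (a + q + k) p)
swap-raise {p = p} (block₄ _ refl) = m≤m+n _ p

-- The graph does not imply the bound: the identity has this graph whenever `a ≥ n`.
record Follows {n} (a p q : ℕ) (ω : Permutation′ n) : Set where
  constructor mkFollows
  field
    bound : a + p + q ≤ n
    graph : ∀ i → BlockSwap a p q (toℕ i) (toℕ (ω ⟨$⟩ʳ i))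

open Follows

follows-flip : {ω : Permutation′ n} → Follows a p q ω → Follows a q p (flip ω)
follows-flip {n} {a} {p} {q} {ω} F = mkFollows
  (subst (_≤ n) (lem a p q) (bound F))
  (λ y → subst (λ z → BlockSwap a q p z (toℕ (ω ⟨$⟩ˡ y)))
     (cong toℕ (inverseʳ ω)) (swap-sym (graph F (ω ⟨$⟩ˡ y))))
  where
  lem : ∀ a p q → a + p + q ≡ a + q + p
  lem = solve-∀

follows-≈ : {π σ : Permutation′ n} → Follows a p q π → Follows a p q σ → π ≈ σ
follows-≈ F G i = toℕ-injective (swap-functional (graph F i) (graph G i))

record Wider (a′ p′ q′ a p q : ℕ) : Set where
  constructor mkWider
  field
    a≥ : a′ ≤ a
    p≤ : p ≤ p′
    q≤ : q ≤ q′
    c≤ : a + p + q ≤ a′ + p′ + q′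

-- At the corner (a + q, a + p) the two quadrants of π hold q and p points.
-- Each inequality is the pigeonhole principle for the positions or the values
-- of their images, which σ confines to an interval.
⊑⇒wider : {π σ : Permutation′ n} → p > 0 → q > 0 →
  Follows a p q π → Follows a′ p′ q′ σ → π ⊑ σ → Wider a′ p′ q′ a p q
⊑⇒wider {n} {p} {q} {a} {a′} {p′} {q′} {π} {σ} p>0 q>0 F G π⊑σ
  with g , g-inj , g-up , g-down ← embed π⊑σ (a + q) (a + p) = mkWider a′≤a p≤p′ q≤q′ c≤c′
  where
  open ≤-Reasoning

  σ′ : Fin n → ℕ
  σ′ x = toℕ (σ ⟨$⟩ʳ x)

  shuffle : ∀ a p q → a + q + p ≡ a + p + q
  shuffle = solve-∀

  up< : ∀ (k : Fin q) → a + toℕ k < n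
  up< k = <-≤-trans (+-monoʳ-< a (toℕ<n k)) (≤-trans (+-monoˡ-≤ q (m≤m+n a p)) (bound F))

  down< : ∀ (k : Fin p) → a + q + toℕ k < n
  down< k = <-≤-trans (+-monoʳ-< (a + q) (toℕ<n k))
    (≤-trans (≤-reflexive (shuffle a p q)) (bound F))

  up : Fin q → Fin n
  up k = fromℕ< (up< k)

  down : Fin p → Fin n
  down k = fromℕ< (down< k)

  up-inj : Injective _≡_ _≡_ up
  up-inj {k} {l} e = toℕ-injective (+-cancelˡ-≡ a _ _
    (trans (sym (toℕ-fromℕ< (up< k))) (trans (cong toℕ e) (toℕ-fromℕ< (up< l)))))

  down-inj : Injective _≡_ _≡_ down
  down-inj {k} {l} e = toℕ-injective (+-cancelˡ-≡ (a + q) _ _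
    (trans (sym (toℕ-fromℕ< (down< k))) (trans (cong toℕ e) (toℕ-fromℕ< (down< l)))))

  gup : ∀ k → toℕ (g (up k)) < a + q × a + p ≤ σ′ (g (up k))
  gup k = g-up (up k)
    (subst (_< a + q) (sym (toℕ-fromℕ< (up< k))) (+-monoʳ-< a (toℕ<n k)))
    (subst (a + p ≤_)
      (sym (swap-functional (graph F (up k)) (block₂ (toℕ k) (toℕ<n k) (toℕ-fromℕ< (up< k)) refl)))
      (m≤m+n (a + p) (toℕ k)))

  gdown : ∀ k → a + q ≤ toℕ (g (down k)) × σ′ (g (down k)) < a + p
  gdown k = g-down (down k)
    (subst (a + q ≤_) (sym (toℕ-fromℕ< (down< k))) (m≤m+n (a + q) (toℕ k)))
    (subst (_< a + p)
      (sym (swap-functional (graph F (down k)) (block₃ (toℕ k) (toℕ<n k) (toℕ-fromℕ< (down< k)) refl)))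
      (+-monoʳ-< a (toℕ<n k)))

  a<a+p : a < a + p
  a<a+p = m<m+n a p>0

  a′≤a : a′ ≤ a
  a′≤a with a′ ≤? a
  ... | yes a′≤a = a′≤a
  -- `σ` fixes positions below `a′`, so an image there has position equal to its value, at least
  -- `a + p`. Hence `q` positions lie between `a′ ⊓ (a + p)` and `a + q`, although that minimum
  -- exceeds `a`.
  ... | no  a′≰a = contradiction
    (+-cancelʳ-≤ q _ a (injection-into-interval (toℕ ∘ g ∘ up)
      (up-inj ∘ g-inj ∘ toℕ-injective) q>0 (λ k → lower k , proj₁ (gup k))))
    (<⇒≱ (⊓-glb (≰⇒> a′≰a) a<a+p))
    where
    lower : ∀ k → a′ ⊓ (a + p) ≤ toℕ (g (up k))
    lower k with toℕ (g (up k)) <? a′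
    ... | no  ≮ = ≤-trans (m⊓n≤m a′ _) (≮⇒≥ ≮)
    ... | yes x<a′ = ≤-trans (m⊓n≤n a′ _) (≤-trans (proj₂ (gup k))
                       (≤-reflexive (swap-functional (graph G _) (block₁ x<a′ refl))))

  c≤c′ : a + p + q ≤ a′ + p′ + q′
  c≤c′ with a + p + q ≤? a′ + p′ + q′
  ... | yes c≤c′ = c≤c′
  -- The same with values: `σ` fixes values from `a′ + p′ + q′` on, so such a value equals its
  -- position, which is below `a + q`.
  ... | no  c≰c′ = contradiction
    (injection-into-interval (σ′ ∘ g ∘ up)
      (up-inj ∘ g-inj ∘ perm-injective σ ∘ toℕ-injective) q>0 (λ k → proj₂ (gup k) , upper k))
    (<⇒≱ (⊔-lub (≰⇒> c≰c′) (+-monoˡ-< q a<a+p)))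
    where
    upper : ∀ k → σ′ (g (up k)) < (a′ + p′ + q′) ⊔ (a + q)
    upper k with a′ + p′ + q′ ≤? σ′ (g (up k))
    ... | no  ≰ = <-≤-trans (≰⇒> ≰) (m≤m⊔n _ _)
    ... | yes c′≤v = <-≤-trans
      (subst (_< a + q)
        (swap-functional (swap-sym (graph G _))
          (block₄ (subst (_≤ σ′ (g (up k))) (sym (shuffle a′ p′ q′)) c′≤v) refl))
        (proj₁ (gup k)))
      (m≤n⊔m (a′ + p′ + q′) (a + q))

  p≤p′ : p ≤ p′
  -- Values are at least `a + p` and `σ` raises by at most `p′`, so the `q` positions start at
  -- `a + p ∸ p′` or later.
  p≤p′ = +-cancelˡ-≤ a p p′ (m∸n≤o⇒m≤o+n (a + p) p′
    (+-cancelʳ-≤ q _ a (injection-into-interval (toℕ ∘ g ∘ up)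
      (up-inj ∘ g-inj ∘ toℕ-injective) q>0 (λ k → lower k , proj₁ (gup k)))))
    where
    m∸n≤o⇒m≤o+n : ∀ m n {o} → m ∸ n ≤ o → m ≤ o + n
    m∸n≤o⇒m≤o+n m n {o} le = ≤-trans (m≤n+m∸n m n)
      (≤-trans (+-monoʳ-≤ n le) (≤-reflexive (+-comm n o)))
    lower : ∀ k → a + p ∸ p′ ≤ toℕ (g (up k))
    lower k = m≤n+o⇒m∸n≤o (a + p) p′ (≤-trans (proj₂ (gup k))
      (≤-trans (swap-raise (graph G (g (up k)))) (≤-reflexive (+-comm _ p′))))

  q≤q′ : q ≤ q′
  -- The other quadrant: values are below `a + p` and `σ` lowers by at most `q′`, so the `p`
  -- positions lie between `a + q` and `a + p + q′`.
  q≤q′ = +-cancelˡ-≤ (a + p) q q′ (begin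
    a + p + q   ≡⟨ shuffle a p q ⟨
    a + q + p   ≤⟨ injection-into-interval (toℕ ∘ g ∘ down)
                     (down-inj ∘ g-inj ∘ toℕ-injective) p>0
                     (λ k → proj₁ (gdown k) , upper k) ⟩
    a + p + q′  ∎)
    where
    upper : ∀ k → toℕ (g (down k)) < a + p + q′
    upper k = ≤-<-trans (swap-raise (swap-sym (graph G (g (down k))))) (+-monoˡ-< q′ (proj₂ (gdown k)))

-- Sufficiency: chains of reductions between block swaps.

transposed-sym : ∀ {i j x y : Fin n} → Transposed i j x y → Transposed i j y x
transposed-sym left        = right
transposed-sym right       = left
transposed-sym (fixed u v) = fixed u v

transposed-swap : ∀ {i j x y : Fin n} → Transposed i j x y → Transposed j i x y
transposed-swap left        = right
transposed-swap right       = left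
transposed-swap (fixed u v) = fixed v u

transposed-functional : ∀ {i j x y z : Fin n} →
  Transposed i j x y → Transposed i j x z → y ≡ z
transposed-functional left        left        = refl
transposed-functional left        right       = refl
transposed-functional left        (fixed u _) = contradiction refl u
transposed-functional right       left        = refl
transposed-functional right       right       = refl
transposed-functional right       (fixed _ v) = contradiction refl v
transposed-functional (fixed u _) left        = contradiction refl u
transposed-functional (fixed _ v) right       = contradiction refl v
transposed-functional (fixed _ _) (fixed _ _) = refl

transposed-map : (ω : Permutation′ n) → ∀ {i j x y} → Transposed i j x y →
  Transposed (ω ⟨$⟩ʳ i) (ω ⟨$⟩ʳ j) (ω ⟨$⟩ʳ x) (ω ⟨$⟩ʳ y)
transposed-map ω left        = left
transposed-map ω right       = right
transposed-map ω (fixed u v) = fixed (u ∘ perm-injective ω) (v ∘ perm-injective ω)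

-- In the inverse, the entries `l` and `k` stand at positions `σ l < σ k` in decreasing order.
-- Conjugation by `σ` turns the transposition of `k`, `l` into that of `σ k`, `σ l`.
reduction-flip : {σ τ : Permutation′ n} → σ reducesTo τ → flip σ reducesTo flip τ
reduction-flip {σ = σ} {τ} (k , l , k<l , σk>σl , τ≈) =
  σ ⟨$⟩ʳ l , σ ⟨$⟩ʳ k , σk>σl
  , subst₂ _<_ (cong toℕ (sym (inverseˡ σ))) (cong toℕ (sym (inverseˡ σ))) k<l
  , λ y → trans (sym (inverseˡ σ)) (cong (σ ⟨$⟩ˡ_) (transposed-functional
      (transposed-swap (transposed-sym (subst (Transposed _ _ _)
        (trans (sym (τ≈ (τ ⟨$⟩ˡ y))) (inverseʳ τ))
        (transposed-map σ (transposed k l (τ ⟨$⟩ˡ y))))))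
      (transposed (σ ⟨$⟩ʳ l) (σ ⟨$⟩ʳ k) y)))

-- The permutation ω ∘ Shift s r k moves the entry of ω at position s right
-- to position r + k, past the entries at positions r, …, r + k.
data Shift (s r k x y : ℕ) : Set where
  head  : x ≡ s → y ≡ r → Shift s r k x y
  slide : r ≤ x → x < r + k → y ≡ suc x → Shift s r k x y
  last  : x ≡ r + k → y ≡ s → Shift s r k x y
  keep  : x ≢ s → x < r ⊎ r + k < x → y ≡ x → Shift s r k x y

Shifts : ℕ → ℕ → ℕ → Permutation′ n → Permutation′ n → Set
Shifts s r k ω τ = ∀ x → ∃[ y ] τ ⟨$⟩ʳ x ≡ ω ⟨$⟩ʳ y × Shift s r k (toℕ x) (toℕ y)

-- The entry at `i` is exchanged in turn with those at `r`, ..., `r + k`, each time a reduction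
-- because it exceeds them all. After the first exchange it stands at `r`, where the induction
-- resumes with `suc r`.
bubble : ∀ k r (i : Fin n) (ω : Permutation′ n) → toℕ i < r → r + k < n →
  (∀ j → r ≤ toℕ j → toℕ j ≤ r + k → ω ⟨$⟩ʳ j Fin.< ω ⟨$⟩ʳ i) →
  ∃[ τ ] Star _reducesTo_ ω τ × Shifts (toℕ i) r k ω τ
bubble {n} zero r i ω i<r r<n small =
  transpose i j ∘ₚ ω
  , (i , j , subst (toℕ i <_) (sym j≡) i<r
      , small j (≤-reflexive (sym j≡)) (≤-reflexive (trans j≡ (sym (+-identityʳ r))))
      , λ _ → refl) ◅ ε
  , λ x → transpose i j ⟨$⟩ʳ x , refl , shift (transposed i j x)
  where
  j<n : r < n
  j<n = subst (_< n) (+-identityʳ r) r<n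
  j : Fin n
  j = fromℕ< j<n
  j≡ : toℕ j ≡ r
  j≡ = toℕ-fromℕ< j<n
  shift : ∀ {x y} → Transposed i j x y → Shift (toℕ i) r 0 (toℕ x) (toℕ y)
  shift left  = head refl j≡
  shift right = last (trans j≡ (sym (+-identityʳ r))) refl
  shift {x} (fixed x≢i x≢j) with <-cmp (toℕ x) r
  ... | tri< x<r _ _ = keep (x≢i ∘ toℕ-injective) (inj₁ x<r) refl
  ... | tri≈ _ x≡r _ = contradiction (toℕ-injective (trans x≡r (sym j≡))) x≢j
  ... | tri> _ _ r<x =
    keep (x≢i ∘ toℕ-injective) (inj₂ (subst (_< toℕ x) (sym (+-identityʳ r)) r<x)) refl
bubble {n} (suc k) r i ω i<r r+1+k<n small =
  let τ , chain , shifts = bubble k (suc r) j ω₁ (s≤s (≤-reflexive j≡)) 1+r+k<n small₁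
  in τ
   , (i , j , subst (toℕ i <_) (sym j≡) i<r
       , small j (≤-reflexive (sym j≡)) (≤-trans (≤-reflexive j≡) (m≤m+n r (suc k)))
       , λ _ → refl) ◅ chain
   , λ x → let y , τx≡ω₁y , s = shifts x in
       transpose i j ⟨$⟩ʳ y , τx≡ω₁y
       , shift (subst (λ j → Shift j (suc r) k (toℕ x) (toℕ y)) j≡ s) (transposed i j y)
  where
  1+r+k<n : suc r + k < n
  1+r+k<n = subst (_< n) (+-suc r k) r+1+k<n
  j<n : r < n
  j<n = ≤-<-trans (m≤m+n r (suc k)) r+1+k<n
  j : Fin n
  j = fromℕ< j<n
  j≡ : toℕ j ≡ r
  j≡ = toℕ-fromℕ< j<n
  ω₁ : Permutation′ n
  ω₁ = transpose i j ∘ₚ ω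
  small₁ : ∀ l → suc r ≤ toℕ l → toℕ l ≤ suc r + k → ω₁ ⟨$⟩ʳ l Fin.< ω₁ ⟨$⟩ʳ j
  small₁ l r<l l≤ with transpose i j ⟨$⟩ʳ l | transposed i j l
                     | transpose i j ⟨$⟩ʳ j | transposed i j j
  ... | _ | left | _ | _ = contradiction i<r (<⇒≯ r<l)
  ... | _ | right | _ | _ = contradiction (sym j≡) (<⇒≢ r<l)
  ... | _ | fixed _ _ | _ | left = contradiction j≡ (<⇒≢ i<r)
  ... | _ | fixed _ _ | _ | right = small l (<⇒≤ r<l) (≤-trans l≤ (≤-reflexive (sym (+-suc r k))))
  ... | _ | fixed _ _ | _ | fixed _ j≢j = contradiction refl j≢j
  -- Composition with the first exchange: position `i`, kept by the inductive shift, becomes the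
  -- head, and the inductive head `r` becomes the first sliding position.
  shift : ∀ {x y z} → Shift r (suc r) k x (toℕ y) → Transposed i j y z →
    Shift (toℕ i) r (suc k) x (toℕ z)
  shift (head x≡r y≡1+r) left  = contradiction y≡1+r (<⇒≢ (m<n⇒m<1+n i<r))
  shift (head x≡r y≡1+r) right = contradiction (trans (sym j≡) y≡1+r) (<⇒≢ (n<1+n r))
  shift {x} (head x≡r y≡1+r) (fixed _ _) =
    slide (≤-reflexive (sym x≡r)) (subst (_< r + suc k) (sym x≡r) (m<m+n r z<s))
      (trans y≡1+r (cong suc (sym x≡r)))
  shift (slide r<x x< y≡1+x) left =
    contradiction y≡1+x (<⇒≢ (m<n⇒m<1+n (<-trans i<r r<x)))
  shift (slide r<x x< y≡1+x) right =
    contradiction (trans (sym j≡) y≡1+x) (<⇒≢ (m<n⇒m<1+n r<x))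
  shift {x} (slide r<x x< y≡1+x) (fixed _ _) =
    slide (<⇒≤ r<x) (subst (x <_) (sym (+-suc r k)) x<) y≡1+x
  shift (last x≡ y≡r) left  = contradiction y≡r (<⇒≢ i<r)
  shift (last x≡ y≡r) right = last (trans x≡ (sym (+-suc r k))) refl
  shift (last x≡ y≡r) (fixed _ y≢j) =
    contradiction (toℕ-injective (trans y≡r (sym j≡))) y≢j
  shift (keep x≢r out refl) left  = head refl j≡
  shift (keep x≢r out refl) right = contradiction j≡ x≢r
  shift (keep x≢r (inj₁ x<1+r) refl) (fixed x≢i _) =
    keep (x≢i ∘ toℕ-injective) (inj₁ (≤∧≢⇒< (s≤s⁻¹ x<1+r) x≢r)) refl
  shift {x} (keep x≢r (inj₂ r+k<x) refl) (fixed x≢i _) =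
    keep (x≢i ∘ toℕ-injective) (inj₂ (subst (_< x) (sym (+-suc r k)) r+k<x)) refl

-- Quantifying over `n` and `ω` leaves a relation between triples, which composes and is symmetric
-- under inversion.
Reaches : ℕ → ℕ → ℕ → ℕ → ℕ → ℕ → Set
Reaches a p q a′ p′ q′ = ∀ {n} {ω : Permutation′ n} → Follows a p q ω →
  ∃[ τ ] Star _reducesTo_ ω τ × Follows a′ p′ q′ τ

reaches-flip : Reaches a q p a′ q′ p′ → Reaches a p q a′ p′ q′
reaches-flip reach F =
  let τ , chain , G = reach (follows-flip F)
  in flip τ , gmap flip (λ {σ} {τ} → reduction-flip {σ = σ} {τ}) chain , follows-flip G

reaches-trans : ∀ {a″ p″ q″} →
  Reaches a p q a′ p′ q′ → Reaches a′ p′ q′ a″ p″ q″ → Reaches a p q a″ p″ q″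
reaches-trans reach reach′ F =
  let τ , chain , G = reach F
      τ′ , chain′ , G′ = reach′ G
  in τ′ , chain ◅◅ chain′ , G′

-- An entry of block 2 moves right past the whole of block 3.
reaches-by-shift : ∀ {a k q a′} m → m < suc q → a′ + suc k + q ≤ a + suc k + suc q →
  (∀ {x y z} → Shift (a + m) (a + suc q) k x y → BlockSwap a (suc k) (suc q) y z →
     BlockSwap a′ (suc k) q x z) →
  Reaches a (suc k) (suc q) a′ (suc k) q
reaches-by-shift {a} {k} {q} {a′} m m<1+q c′≤c shift {n} {ω} F =
  let τ , chain , shifts = bubble k (a + suc q) i ω
        (subst (_< a + suc q) (sym i≡) (+-monoʳ-< a m<1+q)) r+k<n small
  in τ , chain , mkFollows (≤-trans c′≤c (bound F)) λ x →
       let y , τx≡ωy , s = shifts x in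
       shift (subst (λ s → Shift s (a + suc q) k (toℕ x) (toℕ y)) i≡ s)
         (subst (BlockSwap a (suc k) (suc q) (toℕ y)) (cong toℕ (sym τx≡ωy)) (graph F y))
  where
  r+k<n : a + suc q + k < n
  r+k<n = ≤-trans (≤-reflexive (lem a q k)) (bound F)
    where
    lem : ∀ a q k → suc (a + suc q + k) ≡ a + suc k + suc q
    lem = solve-∀
  i<n : a + m < n
  i<n = <-trans (<-≤-trans (+-monoʳ-< a m<1+q) (m≤m+n (a + suc q) k)) r+k<n
  i : Fin n
  i = fromℕ< i<n
  i≡ : toℕ i ≡ a + m
  i≡ = toℕ-fromℕ< i<n
  small : ∀ j → a + suc q ≤ toℕ j → toℕ j ≤ a + suc q + k → ω ⟨$⟩ʳ j Fin.< ω ⟨$⟩ʳ i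
  small j r≤j j≤ with m≤n⇒∃[o]m+o≡n r≤j
  ... | l , e = begin-strict
    toℕ (ω ⟨$⟩ʳ j)  ≡⟨ swap-functional (graph F j) (block₃ l l<1+k (sym e) refl) ⟩
    a + l           <⟨ +-monoʳ-< a l<1+k ⟩
    a + suc k       ≤⟨ m≤m+n (a + suc k) m ⟩
    a + suc k + m   ≡⟨ swap-functional (graph F i) (block₂ m m<1+q i≡ refl) ⟨
    toℕ (ω ⟨$⟩ʳ i)  ∎
    where
    open ≤-Reasoning
    l<1+k : l < suc k
    l<1+k = s≤s (+-cancelˡ-≤ (a + suc q) l k (≤-trans (≤-reflexive e) j≤))

-- The first entry of block 2 moves, with `m = 0`. The value `a` drops into position `a` and becomes
-- fixed, while the moved value `a + p` extends block 3; the end `a + p + q` of the moved range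
-- stays.
shrink-left : p > 0 → Reaches a p (suc q) (suc a) p q
shrink-left {suc k} {a} {q} _ = reaches-by-shift 0 z<s (≤-reflexive (lem a k q)) shift
  where
  lem : ∀ a k q → suc a + suc k + q ≡ a + suc k + suc q
  lem = solve-∀
  shift : ∀ {x y z} → Shift (a + 0) (a + suc q) k x y → BlockSwap a (suc k) (suc q) y z →
    BlockSwap (suc a) (suc k) q x z
  shift (head refl refl) b = block₁ (s≤s (≤-reflexive (+-identityʳ a)))
    (swap-functional b (block₃ 0 z<s (sym (+-identityʳ _)) refl))
  shift (slide r≤x x<r+k refl) b with m≤n⇒∃[o]m+o≡n r≤x
  ... | m , refl = block₃ m (m<n⇒m<1+n m<k) (cong (_+ m) (+-suc a q))
    (trans (swap-functional b (block₃ (suc m) (s≤s m<k) (sym (+-suc _ m)) refl)) (+-suc a m))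
    where
    m<k : m < k
    m<k = +-cancelˡ-< (a + suc q) m k x<r+k
  shift (last refl refl) b = block₃ k ≤-refl (cong (_+ k) (+-suc a q))
    (trans (swap-functional b (block₂ 0 z<s refl refl)) (eq a k))
    where
    eq : ∀ a k → a + suc k + 0 ≡ suc a + k
    eq = solve-∀
  shift {x} (keep x≢a (inj₁ x<r) refl) b with <-cmp x a
  ... | tri< x<a _ _ = block₁ (m<n⇒m<1+n x<a) (swap-functional b (block₁ x<a refl))
  ... | tri≈ _ x≡a _ = contradiction (trans x≡a (sym (+-identityʳ a))) x≢a
  ... | tri> _ _ a<x with m≤n⇒∃[o]m+o≡n a<x
  ...   | m , refl = block₂ m m<q refl
    (trans (swap-functional b (block₂ (suc m) (s≤s m<q) (sym (+-suc a m)) refl)) (+-suc (a + suc k) m))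
    where
    m<q : m < q
    m<q = +-cancelˡ-< (suc a) m q (<-≤-trans x<r (≤-reflexive (+-suc a q)))
  shift {x} (keep x≢a (inj₂ r+k<x) refl) b = block₄ (≤-trans (≤-reflexive (e₁ a k q)) r+k<x)
    (swap-functional b (block₄ (≤-trans (≤-reflexive (e₂ a k q)) r+k<x) refl))
    where
    e₁ : ∀ a k q → suc a + suc k + q ≡ suc (a + suc q + k)
    e₁ = solve-∀
    e₂ : ∀ a k q → a + suc k + suc q ≡ suc (a + suc q + k)
    e₂ = solve-∀

-- The last entry of block 2 moves, with `m = q`. It carries the largest value of the moved range
-- and lands on its own position, so the range loses its right end.
shrink-right : p > 0 → Reaches a p (suc q) a p q
shrink-right {suc k} {a} {q} _ =
  reaches-by-shift q ≤-refl (+-monoʳ-≤ (a + suc k) (n≤1+n q)) shift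
  where
  shift : ∀ {x y z} → Shift (a + q) (a + suc q) k x y → BlockSwap a (suc k) (suc q) y z →
    BlockSwap a (suc k) q x z
  shift (head refl refl) b = block₃ 0 z<s (sym (+-identityʳ _))
    (swap-functional b (block₃ 0 z<s (sym (+-identityʳ _)) refl))
  shift (slide r≤x x<r+k refl) b with m≤n⇒∃[o]m+o≡n r≤x
  ... | m , refl = block₃ (suc m) (s≤s m<k) (eq a q m)
    (swap-functional b (block₃ (suc m) (s≤s m<k) (sym (+-suc _ m)) refl))
    where
    m<k : m < k
    m<k = +-cancelˡ-< (a + suc q) m k x<r+k
    eq : ∀ a q m → a + suc q + m ≡ a + q + suc m
    eq = solve-∀
  shift (last refl refl) b = block₄ (≤-reflexive (eq a k q))
    (trans (swap-functional b (block₂ q ≤-refl refl refl)) (eq a k q))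
    where
    eq : ∀ a k q → a + suc k + q ≡ a + suc q + k
    eq = solve-∀
  shift {x} (keep x≢s (inj₁ x<r) refl) b with x <? a
  ... | yes x<a = block₁ x<a (swap-functional b (block₁ x<a refl))
  ... | no  x≮a with m≤n⇒∃[o]m+o≡n (≮⇒≥ x≮a)
  ...   | m , refl = block₂ m m<q refl
    (swap-functional b (block₂ m (m<n⇒m<1+n m<q) refl refl))
    where
    m<q : m < q
    m<q = ≤∧≢⇒< (s≤s⁻¹ (+-cancelˡ-< a m (suc q) x<r)) (x≢s ∘ cong (a +_))
  shift {x} (keep x≢s (inj₂ r+k<x) refl) b =
    block₄ (≤-trans (+-monoʳ-≤ (a + suc k) (n≤1+n q)) c≤x) (swap-functional b (block₄ c≤x refl))
    where
    eq : ∀ a k q → a + suc k + suc q ≡ suc (a + suc q + k)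
    eq = solve-∀
    c≤x : a + suc k + suc q ≤ x
    c≤x = ≤-trans (≤-reflexive (eq a k q)) r+k<x

-- Of the `u + v` unit steps, `w` raise the left end and the others lower the right end. Steps on
-- `p` are the inverses of steps on `q`; `rewrite` passes the raised start `suc a` to the induction.
reaches-narrower : p > 0 → q > 0 → ∀ u v w → w ≤ u + v →
  Reaches a (u + p) (v + q) (w + a) p q
reaches-narrower p>0 q>0 0 0 0 _ F = _ , ε , F
reaches-narrower p>0 q>0 0 (suc v) 0 _ =
  reaches-trans (shrink-right p>0) (reaches-narrower p>0 q>0 0 v 0 z≤n)
reaches-narrower {a = a} p>0 q>0 0 (suc v) (suc w) (s≤s w≤) rewrite sym (+-suc w a) =
  reaches-trans (shrink-left p>0) (reaches-narrower p>0 q>0 0 v w w≤)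
reaches-narrower p>0 q>0 (suc u) v 0 _ =
  reaches-trans (reaches-flip (shrink-right (m≤n⇒m≤o+n v q>0)))
    (reaches-narrower p>0 q>0 u v 0 z≤n)
reaches-narrower {a = a} p>0 q>0 (suc u) v (suc w) (s≤s w≤) rewrite sym (+-suc w a) =
  reaches-trans (reaches-flip (shrink-left (m≤n⇒m≤o+n v q>0)))
    (reaches-narrower p>0 q>0 u v w w≤)

wider⇒≤ᴮ : {π σ : Permutation′ n} → p > 0 → q > 0 →
  Follows a p q π → Follows a′ p′ q′ σ → Wider a′ p′ q′ a p q → π ≤ᴮ σ
wider⇒≤ᴮ {p = p} {q} {a} {a′} {p′} {q′} p>0 q>0 F G (mkWider a≥ p≤ q≤ c≤)
  -- With the differences named `w`, `u`, `v`, the inequality between the right ends becomes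
  -- `w ≤ u + v`.
  with a ∸ a′ | m∸n+n≡m a≥ | p′ ∸ p | m∸n+n≡m p≤ | q′ ∸ q | m∸n+n≡m q≤
... | w | refl | u | refl | v | refl =
  let τ , chain , H = reaches-narrower p>0 q>0 u v w w≤u+v G
  in τ , chain , follows-≈ H F
  where
  e₁ : ∀ a p q w → w + a + p + q ≡ w + (a + p + q)
  e₁ = solve-∀
  e₂ : ∀ a p q u v → a + (u + p) + (v + q) ≡ u + v + (a + p + q)
  e₂ = solve-∀
  w≤u+v : w ≤ u + v
  w≤u+v = +-cancelʳ-≤ (a′ + p + q) w (u + v)
    (subst₂ _≤_ (e₁ a′ p q w) (e₂ a′ p q u v) c≤)

≤ᴮ⇔wider : {π σ : Permutation′ n} → p > 0 → q > 0 →
  Follows a p q π → Follows a′ p′ q′ σ → π ≤ᴮ σ ⇔ Wider a′ p′ q′ a p q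
≤ᴮ⇔wider p>0 q>0 F G =
  mk⇔ (λ π≤σ → ⊑⇒wider p>0 q>0 F G (≤ᴮ⇒⊑ π≤σ)) (wider⇒≤ᴮ p>0 q>0 F G)

-- The order on length vectors and its reversal by 2143.

infix 4 _∼_ _≤ˡ_ _≐_

-- A record, because `HasLengthVector` unfolds to a statement from which `ℓ` cannot be inferred.
record _∼_ (ω : Permutation′ n) (ℓ : LengthVector n) : Set where
  constructor correct
  field
    hasLengthVector : ω HasLengthVector ℓ

open _∼_

follows : {ω : Permutation′ n} {ℓ : LengthVector n} → ω ∼ ℓ →
  Follows (pred (len₁ ℓ)) (len₂ ℓ) (len₃ ℓ) ω
follows {ℓ = ℓ} ω∼ℓ = mkFollows (FromLengthVector.c≤n ℓ) (hasLengthVector ω∼ℓ)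

record _≤ˡ_ (ℓ m : LengthVector n) : Set where
  constructor mk≤ˡ
  field
    ≥₁ : len₁ m ≤ len₁ ℓ
    ≤₂ : len₂ ℓ ≤ len₂ m
    ≤₃ : len₃ ℓ ≤ len₃ m
    ≥₄ : len₄ m ≤ len₄ ℓ

_≐_ : LengthVector n → LengthVector n → Set
ℓ ≐ m = len₁ ℓ ≡ len₁ m × len₂ ℓ ≡ len₂ m × len₃ ℓ ≡ len₃ m × len₄ ℓ ≡ len₄ m

swap₂₁₄₃-antitone : {ℓ m : LengthVector n} → ℓ ≤ˡ m → swap₂₁₄₃ m ≤ˡ swap₂₁₄₃ ℓ
swap₂₁₄₃-antitone (mk≤ˡ ≥₁ ≤₂ ≤₃ ≥₄) = mk≤ˡ ≤₂ ≥₁ ≥₄ ≤₃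

-- Swapping twice restores the entries definitionally; only the proof of the sum differs.
∼-swap-swap : {ω : Permutation′ n} {ℓ : LengthVector n} →
  ω ∼ ℓ → ω ∼ swap₂₁₄₃ (swap₂₁₄₃ ℓ)
∼-swap-swap ω∼ℓ = correct (hasLengthVector ω∼ℓ)

≤ˡ-antisym : {ℓ m : LengthVector n} → ℓ ≤ˡ m → m ≤ˡ ℓ → ℓ ≐ m
≤ˡ-antisym (mk≤ˡ ≥₁ ≤₂ ≤₃ ≥₄) (mk≤ˡ ≥₁′ ≤₂′ ≤₃′ ≥₄′) =
  ≤-antisym ≥₁′ ≥₁ , ≤-antisym ≤₂ ≤₂′ , ≤-antisym ≤₃ ≤₃′ , ≤-antisym ≥₄′ ≥₄

≤-complement : ∀ x y {d e N} → x + d ≡ N → y + e ≡ N → x ≤ y → e ≤ d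
≤-complement x y {d} {e} x+d≡ y+e≡ x≤y = +-cancelˡ-≤ x e d (begin
  x + e  ≤⟨ +-monoˡ-≤ e x≤y ⟩
  y + e  ≡⟨ trans y+e≡ (sym x+d≡) ⟩
  x + d  ∎)
  where open ≤-Reasoning

-- As the entries sum to `n + 2`, a bound on `a + p + q` is the opposite bound on `ℓ₄`.
wider⇔≤ˡ : (ℓ m : LengthVector n) →
  Wider (pred (len₁ m)) (len₂ m) (len₃ m) (pred (len₁ ℓ)) (len₂ ℓ) (len₃ ℓ) ⇔ ℓ ≤ˡ m
wider⇔≤ˡ (mkLV (suc a) p q d _ _ _ _ e) (mkLV (suc a′) p′ q′ d′ _ _ _ _ e′) = mk⇔
  (λ (mkWider a≥ p≤ q≤ c≤) →
    mk≤ˡ (s≤s a≥) p≤ q≤ (≤-complement (suc (a + p + q)) _ e e′ (s≤s c≤)))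
  (λ (mk≤ˡ a≥ p≤ q≤ d≥) → mkWider (s≤s⁻¹ a≥) p≤ q≤
    (s≤s⁻¹ (≤-complement d′ d (trans (+-comm d′ _) e′) (trans (+-comm d _) e) d≥)))

≤ᴮ⇔≤ˡ : {π σ : Permutation′ n} {ℓ m : LengthVector n} →
  π ∼ ℓ → σ ∼ m → π ≤ᴮ σ ⇔ ℓ ≤ˡ m
≤ᴮ⇔≤ˡ {ℓ = ℓ} {m} π∼ℓ σ∼m = Compose.equivalence
  (≤ᴮ⇔wider (ℓ₂>0 ℓ) (ℓ₃>0 ℓ) (follows π∼ℓ) (follows σ∼m)) (wider⇔≤ˡ ℓ m)

-- Equal permutations lie below each other through empty chains, so antisymmetry of `_≤ˡ_` applies.
∼-unique : {π σ : Permutation′ n} {ℓ m : LengthVector n} →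
  π ∼ ℓ → σ ∼ m → π ≈ σ → ℓ ≐ m
∼-unique {π = π} {σ} π∼ℓ σ∼m π≈σ = ≤ˡ-antisym
  (forth (≤ᴮ⇔≤ˡ π∼ℓ σ∼m) (σ , ε , λ i → sym (π≈σ i)))
  (forth (≤ᴮ⇔≤ˡ σ∼m π∼ℓ) (π , ε , π≈σ))

∼⇒≈ : {π σ : Permutation′ n} {ℓ m : LengthVector n} → π ∼ ℓ → σ ∼ m →
  len₁ ℓ ≡ len₁ m → len₂ ℓ ≡ len₂ m → len₃ ℓ ≡ len₃ m → π ≈ σ
∼⇒≈ π∼ℓ σ∼m refl refl refl = follows-≈ (follows π∼ℓ) (follows σ∼m)

∼-lengthVector : (σ : 𝔅 n) → perm σ ∼ lengthVector σ
∼-lengthVector σ = correct (lengthVector-correct σ)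

elementOf-∼ : (ℓ : LengthVector n) → perm (elementOf ℓ) ∼ ℓ
elementOf-∼ ℓ = correct (elementOf-correct ℓ)

f₂₁₄₃-∼ : (σ : 𝔅 n) → perm (f₂₁₄₃ σ) ∼ swap₂₁₄₃ (lengthVector σ)
f₂₁₄₃-∼ σ = elementOf-∼ (swap₂₁₄₃ (lengthVector σ))

f₂₁₄₃-cong : (π σ : 𝔅 n) → perm π ≈ perm σ → perm (f₂₁₄₃ π) ≈ perm (f₂₁₄₃ σ)
f₂₁₄₃-cong π σ π≈σ =
  let e₁ , e₂ , e₃ , e₄ = ∼-unique (∼-lengthVector π) (∼-lengthVector σ) π≈σ
  in ∼⇒≈ (f₂₁₄₃-∼ π) (f₂₁₄₃-∼ σ) e₂ e₁ e₄

f₂₁₄₃-involutive : (σ : 𝔅 n) → perm (f₂₁₄₃ (f₂₁₄₃ σ)) ≈ perm σ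
f₂₁₄₃-involutive σ =
  let e₁ , e₂ , e₃ , e₄ = ∼-unique (∼-lengthVector (f₂₁₄₃ σ)) (f₂₁₄₃-∼ σ) (λ _ → refl)
  in ∼⇒≈ (f₂₁₄₃-∼ (f₂₁₄₃ σ)) (∼-lengthVector σ) e₂ e₁ e₄

-- The duals are arbitrary permutations with the swapped vectors, so `σ` can itself serve as the
-- dual of `f₂₁₄₃ σ`.
≤ᴮ-dual : {π π* σ σ* : Permutation′ n} {ℓ m : LengthVector n} →
  π ∼ ℓ → π* ∼ swap₂₁₄₃ ℓ → σ ∼ m → σ* ∼ swap₂₁₄₃ m → π ≤ᴮ σ → σ* ≤ᴮ π*
≤ᴮ-dual π∼ℓ π*∼ σ∼m σ*∼ π≤σ =
  back (≤ᴮ⇔≤ˡ σ*∼ π*∼) (swap₂₁₄₃-antitone (forth (≤ᴮ⇔≤ˡ π∼ℓ σ∼m) π≤σ))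

f₂₁₄₃-reverses-≼ : (π σ : 𝔅 n) → π ≼ σ ⇔ f₂₁₄₃ σ ≼ f₂₁₄₃ π
f₂₁₄₃-reverses-≼ π σ = mk⇔
  (≤ᴮ-dual (∼-lengthVector π) (f₂₁₄₃-∼ π) (∼-lengthVector σ) (f₂₁₄₃-∼ σ))
  (≤ᴮ-dual (f₂₁₄₃-∼ σ) (∼-swap-swap (∼-lengthVector σ))
           (f₂₁₄₃-∼ π) (∼-swap-swap (∼-lengthVector π)))

-- `f₂₁₄₃` exchanges the elements above `σ` with those below `σ*`, and is its own inverse.
α-from-β : ∀ {k} (σ σ* : 𝔅 n) {ℓ : LengthVector n} →
  perm σ ∼ ℓ → perm σ* ∼ swap₂₁₄₃ ℓ → β[ σ* ]≐ k → α[ σ ]≐ k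
α-from-β σ σ* σ∼ℓ σ*∼ β = Compose.inverse β record
  { to        = λ (π , π≼σ*) → f₂₁₄₃ π ,
      ≤ᴮ-dual (∼-lengthVector π) (f₂₁₄₃-∼ π) σ*∼ (∼-swap-swap σ∼ℓ) π≼σ*
  ; from      = λ (τ , σ≼τ) → f₂₁₄₃ τ ,
      ≤ᴮ-dual σ∼ℓ σ*∼ (∼-lengthVector τ) (f₂₁₄₃-∼ τ) σ≼τ
  ; to-cong   = λ {(π , _)} {(π′ , _)} → f₂₁₄₃-cong π π′
  ; from-cong = λ {(τ , _)} {(τ′ , _)} → f₂₁₄₃-cong τ τ′
  ; inverse   = (λ {(τ , _)} {(π , _)} → f-inverse π τ) , (λ {(π , _)} {(τ , _)} → f-inverse τ π)
  }
  where
  f-inverse : ∀ π τ → perm π ≈ perm (f₂₁₄₃ τ) → perm (f₂₁₄₃ π) ≈ perm τ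
  f-inverse π τ π≈fτ i = trans (f₂₁₄₃-cong π (f₂₁₄₃ τ) π≈fτ i) (f₂₁₄₃-involutive τ i)

-- Counting the elements below a given one.

Fin-sum↔Σ : ∀ {n} (f : Fin n → ℕ) (B : Fin n → Set) →
  (∀ i → Fin (f i) ↔ B i) → Fin (sum f) ↔ Σ (Fin n) B
Fin-sum↔Σ {zero}  f B f↔B = mk↔ₛ′ (λ ()) (λ ()) (λ ()) (λ ())
Fin-sum↔Σ {suc n} f B f↔B =
  ↔-trans +↔⊎ (↔-trans (f↔B zero ⊎-↔ Fin-sum↔Σ (f ∘ suc) (B ∘ suc) (f↔B ∘ suc))
    (mk↔ₛ′
      (λ { (inj₁ b) → zero , b ; (inj₂ (i , b)) → suc i , b })
      (λ { (zero , b) → inj₁ b ; (suc i , b) → inj₂ (i , b) })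
      (λ { (zero , b) → refl ; (suc i , b) → refl })
      (λ { (inj₁ b) → refl ; (inj₂ (i , b)) → refl })))

-- An arithmetic series, doubled to avoid division. The offset `c` absorbs the index shift when the
-- first summand is split off.
2*sum-suc : ∀ q c → 2 * sum {q} (λ v → suc (c + toℕ v)) ≡ q * (c + c + q + 1)
2*sum-suc zero    c = refl
2*sum-suc (suc q) c = begin
  2 * (suc (c + 0) + sum {q} (λ v → suc (c + suc (toℕ v))))
    ≡⟨ cong (λ s → 2 * (suc (c + 0) + s)) (sum-cong-≗ {q} λ v → cong suc (+-suc c (toℕ v))) ⟩
  2 * (suc (c + 0) + S)
    ≡⟨ *-distribˡ-+ 2 (suc (c + 0)) S ⟩
  2 * suc (c + 0) + 2 * S
    ≡⟨ cong (2 * suc (c + 0) +_) (2*sum-suc q (suc c)) ⟩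
  2 * suc (c + 0) + q * (suc c + suc c + q + 1)
    ≡⟨ lem q c ⟩
  suc q * (c + c + suc q + 1) ∎
  where
  open ≡-Reasoning
  S = sum {q} (λ v → suc (suc c + toℕ v))
  lem : ∀ q c → 2 * suc (c + 0) + q * (suc c + suc c + q + 1) ≡ suc q * (c + c + suc q + 1)
  lem = solve-∀

2*sum-sum-suc : ∀ p q d →
  2 * sum {p} (λ u → sum {q} (λ v → suc (d + toℕ u + toℕ v))) ≡ p * q * (d + d + p + q)
2*sum-sum-suc zero    q d = refl
2*sum-sum-suc (suc p) q d = begin
  2 * (R + sum {p} (λ u → sum {q} (λ v → suc (d + suc (toℕ u) + toℕ v))))
    ≡⟨ cong (λ s → 2 * (R + s)) (sum-cong-≗ {p} λ u → sum-cong-≗ {q} λ v →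
         cong (λ e → suc (e + toℕ v)) (+-suc d (toℕ u))) ⟩
  2 * (R + S)
    ≡⟨ *-distribˡ-+ 2 R S ⟩
  2 * R + 2 * S
    ≡⟨ cong₂ _+_ (2*sum-suc q (d + 0)) (2*sum-sum-suc p q (suc d)) ⟩
  q * (d + 0 + (d + 0) + q + 1) + p * q * (suc d + suc d + p + q)
    ≡⟨ lem p q d ⟩
  suc p * q * (d + d + suc p + q) ∎
  where
  open ≡-Reasoning
  R = sum {q} (λ v → suc (d + 0 + toℕ v))
  S = sum {p} (λ u → sum {q} (λ v → suc (suc d + toℕ u + toℕ v)))
  lem : ∀ p q d → q * (d + 0 + (d + 0) + q + 1) + p * q * (suc d + suc d + p + q)
                ≡ suc p * q * (d + d + suc p + q)
  lem = solve-∀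

-- An element below σ loses u from ℓ₂ and v from ℓ₃; of these u + v positions,
-- t go to ℓ₁ and the others to ℓ₄.
Below : ℕ → ℕ → Set
Below p q = Σ (Fin p) λ u → Σ (Fin q) λ v → Fin (suc (toℕ u + toℕ v))

#Below : ℕ → ℕ → ℕ
#Below p q = sum {p} λ u → sum {q} λ v → suc (toℕ u + toℕ v)

Fin↔Below : ∀ p q → Fin (#Below p q) ↔ Below p q
Fin↔Below p q = Fin-sum↔Σ _ _ λ u → Fin-sum↔Σ _ _ λ v → mk↔ₛ′ id id (λ _ → refl) (λ _ → refl)

-- The equations are between numbers because the types of `t` and `t′` agree only once the first two
-- are matched.
below-≡ : ∀ {u u′ : Fin p} {v v′ : Fin q} {t t′} →
  toℕ u ≡ toℕ u′ → toℕ v ≡ toℕ v′ → toℕ t ≡ toℕ t′ → _≡_ {A = Below p q} (u , v , t) (u′ , v′ , t′)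
below-≡ e e′ e″ with refl ← toℕ-injective e | refl ← toℕ-injective e′
  with refl ← toℕ-injective e″ = refl

-- With `ℓ` as a parameter, `f₂₁₄₃ σ` can be counted through its swapped vector directly.
module _ {n} (σ : 𝔅 n) {ℓ : LengthVector n} (σ∼ℓ : perm σ ∼ ℓ) where

  private
    P = len₂ ℓ
    Q = len₃ ℓ

    belowVector : Below P Q → LengthVector n
    belowVector (u , v , t) = record
      { ℓ₁   = len₁ ℓ + toℕ t
      ; ℓ₂   = P ∸ toℕ u
      ; ℓ₃   = Q ∸ toℕ v
      -- The subtraction is exact, since `t` ranges up to `u + v` inclusive.
      ; ℓ₄   = len₄ ℓ + (toℕ u + toℕ v ∸ toℕ t)
      ; ℓ₁>0 = ≤-trans (ℓ₁>0 ℓ) (m≤m+n _ _)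
      ; ℓ₂>0 = m<n⇒0<n∸m (toℕ<n u)
      ; ℓ₃>0 = m<n⇒0<n∸m (toℕ<n v)
      ; ℓ₄>0 = ≤-trans (ℓ₄>0 ℓ) (m≤m+n _ _)
      ; sum≡ = trans (total (len₁ ℓ) (len₄ ℓ) (m∸n+n≡m (<⇒≤ (toℕ<n u))) (m∸n+n≡m (<⇒≤ (toℕ<n v)))
                       (m∸n+n≡m (s≤s⁻¹ (toℕ<n t)))) (sum≡ ℓ)
      }
      where
      total : ∀ a d {p q u v r t P Q} → p + u ≡ P → q + v ≡ Q → r + t ≡ u + v →
        a + t + p + q + (d + r) ≡ a + P + Q + d
      total a d {p} {q} {u} {v} {r} {t} refl refl r+t≡ = begin
        a + t + p + q + (d + r)    ≡⟨ lem₁ a d p q r t ⟩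
        a + p + q + d + (r + t)    ≡⟨ cong (a + p + q + d +_) r+t≡ ⟩
        a + p + q + d + (u + v)    ≡⟨ lem₂ a d p q u v ⟩
        a + (p + u) + (q + v) + d  ∎
        where
        open ≡-Reasoning
        lem₁ : ∀ a d p q r t → a + t + p + q + (d + r) ≡ a + p + q + d + (r + t)
        lem₁ = solve-∀
        lem₂ : ∀ a d p q u v → a + p + q + d + (u + v) ≡ a + (p + u) + (q + v) + d
        lem₂ = solve-∀

    element : Below P Q → Σ (𝔅 n) (_≼ σ)
    element x@(u , v , t) = elementOf (belowVector x) ,
      back (≤ᴮ⇔≤ˡ (elementOf-∼ (belowVector x)) σ∼ℓ)
        (mk≤ˡ (m≤m+n _ _) (m∸n≤m P (toℕ u)) (m∸n≤m Q (toℕ v)) (m≤m+n _ _))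

    element-injective : ∀ x y →
      perm (proj₁ (element x)) ≈ perm (proj₁ (element y)) → x ≡ y
    element-injective x@(u , v , t) y@(u′ , v′ , t′) x≈y =
      let e₁ , e₂ , e₃ , _ = ∼-unique
            (elementOf-∼ (belowVector x)) (elementOf-∼ (belowVector y)) x≈y
      in below-≡ (∸-cancelˡ-≡ (<⇒≤ (toℕ<n u)) (<⇒≤ (toℕ<n u′)) e₂)
                 (∸-cancelˡ-≡ (<⇒≤ (toℕ<n v)) (<⇒≤ (toℕ<n v′)) e₃)
                 (+-cancelˡ-≡ (len₁ ℓ) _ _ e₁)

    element-surjective : ∀ π → π ≼ σ → ∃[ x ] perm (proj₁ (element x)) ≈ perm π
    element-surjective π π≼σ = x ,
      ∼⇒≈ (elementOf-∼ (belowVector x)) (∼-lengthVector π)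
        (trans (cong (len₁ ℓ +_) (toℕ-fromℕ< t<)) (m+[n∸m]≡n ≥₁))
        (trans (cong (P ∸_) (toℕ-fromℕ< u<)) (m∸[m∸n]≡n ≤₂))
        (trans (cong (Q ∸_) (toℕ-fromℕ< v<)) (m∸[m∸n]≡n ≤₃))
      where
      m = lengthVector π
      open _≤ˡ_ (forth (≤ᴮ⇔≤ˡ (∼-lengthVector π) σ∼ℓ) π≼σ)
      u< : P ∸ len₂ m < P
      u< = ∸-monoʳ-< (ℓ₂>0 m) ≤₂
      v< : Q ∸ len₃ m < Q
      v< = ∸-monoʳ-< (ℓ₃>0 m) ≤₃
      -- The sums agree and `ℓ₄` does not drop, so `ℓ₁` gains at most what `ℓ₂` and `ℓ₃` lose.
      t≤ : ∀ {a d a′ d′ p q u v P Q} → d ≤ d′ → u + p ≡ P → v + q ≡ Q →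
        a′ + p + q + d′ ≡ a + P + Q + d → a′ ≤ a + (u + v)
      t≤ {a} {d} {a′} {d′} {p} {q} {u} {v} d≤d′ refl refl e = +-cancelʳ-≤ (p + q + d) a′ (a + (u + v)) (begin
        a′ + (p + q + d)               ≡⟨ lem₁ a′ p q d ⟩
        a′ + p + q + d                 ≤⟨ +-monoʳ-≤ (a′ + p + q) d≤d′ ⟩
        a′ + p + q + d′                ≡⟨ e ⟩
        a + (u + p) + (v + q) + d      ≡⟨ lem₂ a p q d u v ⟩
        a + (u + v) + (p + q + d)      ∎)
        where
        open ≤-Reasoning
        lem₁ : ∀ a p q d → a + (p + q + d) ≡ a + p + q + d
        lem₁ = solve-∀
        lem₂ : ∀ a p q d u v → a + (u + p) + (v + q) + d ≡ a + (u + v) + (p + q + d)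
        lem₂ = solve-∀
      t< : len₁ m ∸ len₁ ℓ < suc (toℕ (fromℕ< u<) + toℕ (fromℕ< v<))
      t< = s≤s (subst₂ (λ u v → len₁ m ∸ len₁ ℓ ≤ u + v)
        (sym (toℕ-fromℕ< u<)) (sym (toℕ-fromℕ< v<))
        (m≤n+o⇒m∸n≤o (len₁ m) (len₁ ℓ)
          (t≤ ≥₄ (m∸n+n≡m ≤₂) (m∸n+n≡m ≤₃) (trans (sum≡ m) (sym (sum≡ ℓ))))))
      x : Below P Q
      x = fromℕ< u< , fromℕ< v< , fromℕ< t<

  β-value : β[ σ ]≐ #Below P Q
  β-value = Compose.inverse (Fin↔Below P Q) (Bijection⇒Inverse bijection)
    where
    bijection : Bijection (setoid (Below P Q)) (subsetoid (_≼ σ))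
    bijection = record
      { to        = element
      ; cong      = λ { refl _ → refl }
      ; bijective = (λ {x} {y} → element-injective x y)
                  , λ (π , π≼σ) → let x , x≈π = element-surjective π π≼σ in
                      x , λ { refl → x≈π }
      }

corollary2p3 : (n : ℕ) → n ≥ 1 → (π σ : 𝔅 n) →
    let open LengthVector (lengthVector σ) in
    (π ≼ σ ⇔ f₂₁₄₃ σ ≼ f₂₁₄₃ π)
    × (∃[ k ] (β[ σ ]≐ k) × 2 * k ≡ ℓ₂ * ℓ₃ * (ℓ₂ + ℓ₃))
    × (∃[ k ] (α[ σ ]≐ k) × 2 * k ≡ ℓ₁ * ℓ₄ * (ℓ₁ + ℓ₄))
    × (∃[ k ] (β[ σ ]≐ k) × (α[ f₂₁₄₃ σ ]≐ k))
corollary2p3 n n≥1 π σ =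
    f₂₁₄₃-reverses-≼ π σ
  , (#Below (len₂ ℓ) (len₃ ℓ) , βσ , 2*sum-sum-suc (len₂ ℓ) (len₃ ℓ) 0)
  -- `ℓ₁` and `ℓ₄` are the two middle entries of the swapped vector.
  , (#Below (len₁ ℓ) (len₄ ℓ)
    , α-from-β σ fσ σ∼ℓ fσ∼ℓ′ (β-value fσ fσ∼ℓ′)
    , 2*sum-sum-suc (len₁ ℓ) (len₄ ℓ) 0)
  -- Here the roles are exchanged: `σ` is the dual of `fσ`.
  , (#Below (len₂ ℓ) (len₃ ℓ) , βσ , α-from-β fσ σ fσ∼ℓ′ (∼-swap-swap σ∼ℓ) βσ)
  where
  ℓ = lengthVector σ
  fσ = f₂₁₄₃ σ
  σ∼ℓ : perm σ ∼ ℓ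
  σ∼ℓ = ∼-lengthVector σ
  fσ∼ℓ′ : perm fσ ∼ swap₂₁₄₃ ℓ
  fσ∼ℓ′ = f₂₁₄₃-∼ σ
  βσ : β[ σ ]≐ #Below (len₂ ℓ) (len₃ ℓ)
  βσ = β-value σ σ∼ℓ
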